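{- Let $G$ be a finite simple undirected graph on $n$ vertices and let $k$ be an integer with $2 \leq k \leq n$ such that $G$ is $k$-cyclable. Then (i) if $k \leq \sqrt{n+3}$, then $c(G) \geq 2k$; (ii) if $k \leq \frac{3n}{4} - 1$, then $c(G) \geq k+2$. Moreover, for $2 \leq k \leq \sqrt{n+3}$ the bound in (i) is best possible: there exists a $k$-cyclable graph on $n$ vertices whose circumference is exactly $2k$.
   Context: A subset $S \subseteq V(G)$ is cyclable if some cycle of $G$ contains all vertices of $S$ (in some order, possibly together with other vertices). $G$ is $k$-cyclable ($k \geq 2$) if every set of $k$ vertices of $G$ is cyclable. The circumference $c(G)$ is the length of a longest cycle in $G$.
   Formalization: Part (i) and the sharpness claim assume n ≥ 4: for n = 3, k = 2 the triangle is 2-cyclable with circumference 3 < 4, and no graph on 2 or 3 vertices has circumference 4. -}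

module Defs where

open import Data.Nat using (ℕ; _≤_)
open import Data.Bool using (Bool; true; false; T)
open import Data.Fin using (Fin)
open import Data.Fin.Subset using (Subset; _∈_; ∣_∣)
open import Data.List using (List; []; _∷_; _++_; length)
open import Data.List.Relation.Unary.Any using (Any)
open import Data.List.Relation.Unary.Linked using (Linked)
open import Data.List.Relation.Unary.Unique.Propositional using (Unique)
open import Data.Empty using (⊥)
open import Data.Product using (Σ; _×_)
open import Relation.Binary.PropositionalEquality using (_≡_)

record Graph (n : ℕ) : Set where
  field
    adj    : Fin n → Fin n → Bool
    sym    : ∀ u v → adj u v ≡ adj v u
    irrefl : ∀ v → adj v v ≡ false

open Graph public

Adj : ∀ {n} → Graph n → Fin n → Fin n → Set
Adj G u v = T (adj G u v)

IsCycle : ∀ {n} → Graph n → List (Fin n) → Set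
IsCycle G []       = ⊥
IsCycle G (x ∷ xs) =
  (3 ≤ length (x ∷ xs)) × Unique (x ∷ xs) × Linked (Adj G) (x ∷ xs ++ x ∷ [])

_onCycle_ : ∀ {n} → Fin n → List (Fin n) → Set
v onCycle vs = Any (v ≡_) vs

Cyclable : ∀ {n} → Graph n → Subset n → Set
Cyclable G S = Σ (List _) λ C → IsCycle G C × (∀ v → v ∈ S → v onCycle C)

KCyclable : ∀ {n} → ℕ → Graph n → Set
KCyclable k G = ∀ (S : Subset _) → ∣ S ∣ ≡ k → Cyclable G S

IsCircumference : ∀ {n} → Graph n → ℕ → Set
IsCircumference G c =
  (Σ (List _) λ C → IsCycle G C × length C ≡ c)
  × (∀ C → IsCycle G C → length C ≤ c)

{-# OPTIONS --safe #-}
module Submission where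

-- Two tools are used throughout. Window sums: on a cycle D that cannot be enlarged, the neighbours of
-- outside vertices are sparse in every window of consecutive vertices, and summing over all rotations of
-- D bounds the number of neighbours on D. Crossing: for x off D, the vertex x and the successors on D of
-- its neighbours form an independent set.
--
-- (i) An independent k-set lies on a cycle of length at least 2k, so suppose there is none, and let D be
-- a longest cycle, of length less than 2k. Since k ≥ 3, every vertex set is extended by an ear (a cycle
-- through an outside vertex and two inside ones), which yields a linear order in which each vertex off D
-- has an earlier and a later neighbour. Colour the vertices off D by the longest increasing path starting
-- there. Such a path extends to an ear between distinct vertices of D, hence has at most k − 2 vertices,
-- so one of k − 2 colour classes is large.
--
-- (ii) Suppose all cycles have length at most k + 1 and put q = n − k. For every q-set X some maximal
-- cycle misses X up to one vertex. If a vertex x off D has few neighbours off D, then choosing X inside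
-- the crossing set plus two neighbours d₁, d₂ of x contradicts the window bounds. Otherwise a component
-- off D can be shrunk by choosing X without one of its vertices but with successors instead.
--
-- Sharpness is witnessed by complete bipartite graphs with one side of size k.

open import Defs renaming (sym to adj-sym)
open import Data.Bool using (Bool; true; false; T; not; _∧_; _∨_; _xor_)
open import Data.Bool.Properties using (T-∧; T-∨; T?; T-≡; T-not-≡)
open import Data.Bool.Properties using (T-∧; T-∨; T?; T-≡; xor-comm; xor-same)
open import Data.Empty using (⊥; ⊥-elim)
open import Data.Fin using (Fin; zero; suc)
open import Data.Fin using (Fin; zero; suc; toℕ)
import Data.Fin.Properties as F
open import Data.Fin.Properties using (_≟_; any?)
open import Data.Fin.Properties using (_≟_; any?; all?)
import Data.Fin.Subset as Sub
open import Data.List using (List; []; _∷_; _++_; length; map; reverse; filter; allFin)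
open import Data.List using (List; []; _∷_; _++_; length; map; reverse; filter; allFin; [_])
open import Data.List.Membership.Propositional using (_∈_; _∉_)
open import Data.List.Membership.Propositional.Properties
import Data.List.Properties as L
open import Data.List.Relation.Binary.Permutation.Propositional using (_↭_; ↭-sym; ↭-trans; ↭-prep; ↭-refl; ↭-swap; ↭⇒↭ₛ)
open import Data.List.Relation.Binary.Permutation.Propositional.Properties using (∈-resp-↭; ↭-length; shift; shifts; ↭-reverse; ++⁺ʳ; ++-comm)
import Data.List.Relation.Binary.Permutation.Setoid.Properties as PS
open import Data.List.Relation.Binary.Sublist.Propositional using (_⊆_; _∷_; _∷ʳ_; []; ⊆-refl; ⊆-trans; from∈; to∈)
import Data.List.Relation.Binary.Sublist.Propositional.Properties as SL
open import Data.List.Relation.Unary.All as All using (All; []; _∷_)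
open import Data.List.Relation.Unary.All.Properties using (¬Any⇒All¬; All¬⇒¬Any)
open import Data.List.Relation.Unary.AllPairs using (AllPairs; []; _∷_)
open import Data.List.Relation.Unary.Any using (Any; here; there)
open import Data.List.Relation.Unary.Any using (here; there)
open import Data.List.Relation.Unary.Linked using (Linked; []; [-]; _∷_)
open import Data.List.Relation.Unary.Unique.Propositional using (Unique)
import Data.List.Relation.Unary.Unique.Propositional.Properties as U
open import Data.Nat using (ℕ; zero; suc; _+_; _*_; _∸_; _≤_; _<_; z≤n; s≤s; _≤?_; _<?_)
open import Data.Nat using (ℕ; zero; suc; _+_; _*_; _≤_; _<_; z≤n; s≤s; _≤?_; _<?_)
open import Data.Nat.ListAction using (sum)
import Data.Nat.Properties as ℕ
open import Data.Nat.Properties hiding (_≟_)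
open import Data.Nat.Tactic.RingSolver using (solve-∀)
open import Data.Product using (Σ; ∃; ∃₂; _×_; _,_; proj₁; proj₂)
open import Data.Sum using (_⊎_; inj₁; inj₂; [_,_]′)
open import Data.Unit using (tt)
open import Data.Unit using (⊤; tt)
open import Data.Vec using (tabulate)
open import Data.Vec using (tabulate; lookup)
import Data.Vec.Properties as V
open import Function using (_∘_; id; case_of_; Equivalence)
open import Relation.Binary.PropositionalEquality using (_≡_; _≢_; refl; sym; trans; cong; cong₂; subst; subst₂; module ≡-Reasoning)
import Relation.Binary.PropositionalEquality.Properties as ≡P
open import Relation.Nullary using (¬_; Dec; yes; no)
open import Relation.Nullary using (¬_; yes; no)
open import Relation.Nullary.Decidable using (⌊_⌋; toWitness; fromWitness; ¬?; _×-dec_; decidable-stable)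

-- Counting with Boolean-valued sets

bit : Bool → ℕ
bit true  = 1
bit false = 0

bit-T : ∀ {b} → T b → bit b ≡ 1
bit-T {true} _ = refl

bit-¬T : ∀ {b} → ¬ T b → bit b ≡ 0
bit-¬T {true}  h = ⊥-elim (h tt)
bit-¬T {false} _ = refl

bit≤1 : ∀ b → bit b ≤ 1
bit≤1 true  = ≤-refl
bit≤1 false = z≤n

¬T⇒T-not : ∀ {b} → ¬ T b → T (not b)
¬T⇒T-not {true}  h = h tt
¬T⇒T-not {false} _ = tt

T-not⇒¬T : ∀ {b} → T (not b) → ¬ T b
T-not⇒¬T {true} ()

BSet : ℕ → Set
BSet n = Fin n → Bool

infix 4 _∈ᵇ_ _∉ᵇ_ _⊆ᵇ_
infixr 6 _∪ᵇ_
infixr 7 _∩ᵇ_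

_∈ᵇ_ _∉ᵇ_ : ∀ {n} → Fin n → BSet n → Set
v ∈ᵇ p = T (p v)
v ∉ᵇ p = ¬ (v ∈ᵇ p)

_⊆ᵇ_ : ∀ {n} → BSet n → BSet n → Set
p ⊆ᵇ q = ∀ v → v ∈ᵇ p → v ∈ᵇ q

_∩ᵇ_ _∪ᵇ_ : ∀ {n} → BSet n → BSet n → BSet n
(p ∩ᵇ q) v = p v ∧ q v
(p ∪ᵇ q) v = p v ∨ q v

∁ᵇ : ∀ {n} → BSet n → BSet n
∁ᵇ p v = not (p v)

fullᵇ : ∀ {n} → BSet n
fullᵇ _ = true

∈∩⁺ : ∀ {a b} → T a → T b → T (a ∧ b)
∈∩⁺ x y = Equivalence.from T-∧ (x , y)

∈∩⁻ : ∀ {a b} → T (a ∧ b) → T a × T b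
∈∩⁻ = Equivalence.to T-∧

∈∪ˡ : ∀ {a b} → T a → T (a ∨ b)
∈∪ˡ x = Equivalence.from T-∨ (inj₁ x)

∈∪ʳ : ∀ {a b} → T b → T (a ∨ b)
∈∪ʳ x = Equivalence.from T-∨ (inj₂ x)

∈∪⁻ : ∀ {a b} → T (a ∨ b) → T a ⊎ T b
∈∪⁻ = Equivalence.to T-∨

∑ : ∀ {n} → (Fin n → ℕ) → ℕ
∑ {zero}  f = 0
∑ {suc n} f = f zero + ∑ (f ∘ suc)

∑-mono : ∀ {n} {f g : Fin n → ℕ} → (∀ v → f v ≤ g v) → ∑ f ≤ ∑ g
∑-mono {zero}  h = z≤n
∑-mono {suc n} h = +-mono-≤ (h zero) (∑-mono (h ∘ suc))

∑-+ : ∀ {n} (f g : Fin n → ℕ) → ∑ (λ v → f v + g v) ≡ ∑ f + ∑ g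
∑-+ {zero}  f g = refl
∑-+ {suc n} f g rewrite ∑-+ (f ∘ suc) (g ∘ suc) = lem (f zero) (g zero) _ _
  where
  lem : ∀ a b c d → a + b + (c + d) ≡ a + c + (b + d)
  lem = solve-∀

infix 8 #_

-- Opaque, so that counts stay folded in goals and are compared through inclusion, disjointness and
-- covering.
opaque
  #_ : ∀ {n} → BSet n → ℕ
  # p = ∑ (bit ∘ p)

  #-def : ∀ {n} (p : BSet n) → # p ≡ ∑ (bit ∘ p)
  #-def p = refl

#-mono : ∀ {n} {p q : BSet n} → p ⊆ᵇ q → # p ≤ # q
#-mono {p = p} {q} h = subst₂ _≤_ (sym (#-def p)) (sym (#-def q)) (∑-mono λ v → pt (p v) (q v) (h v))
  where
  pt : ∀ a b → (T a → T b) → bit a ≤ bit b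
  pt true  true  _ = ≤-refl
  pt true  false h = ⊥-elim (h tt)
  pt false _     _ = z≤n

∑-#-+ : ∀ {n} (p q : BSet n) → ∑ (λ v → bit (p v) + bit (q v)) ≡ # p + # q
∑-#-+ p q = trans (∑-+ (bit ∘ p) (bit ∘ q)) (sym (cong₂ _+_ (#-def p) (#-def q)))

#-disjoint : ∀ {n} {p q r : BSet n} → p ⊆ᵇ r → q ⊆ᵇ r → (∀ v → v ∈ᵇ p → v ∉ᵇ q) → # p + # q ≤ # r
#-disjoint {p = p} {q} {r} h₁ h₂ d =
  subst₂ _≤_ (∑-#-+ p q) (sym (#-def r)) (∑-mono λ v → pt (p v) (q v) (r v) (h₁ v) (h₂ v) (d v))
  where
  pt : ∀ a b c → (T a → T c) → (T b → T c) → (T a → T b → ⊥) → bit a + bit b ≤ bit c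
  pt true  true  _     _ _ d = ⊥-elim (d tt tt)
  pt true  false true  _ _ _ = ≤-refl
  pt true  false false h _ _ = ⊥-elim (h tt)
  pt false true  true  _ _ _ = ≤-refl
  pt false true  false _ h _ = ⊥-elim (h tt)
  pt false false _     _ _ _ = z≤n

#-cover : ∀ {n} {p q r : BSet n} → (∀ v → v ∈ᵇ r → v ∈ᵇ p ⊎ v ∈ᵇ q) → # r ≤ # p + # q
#-cover {p = p} {q} {r} h =
  subst₂ _≤_ (sym (#-def r)) (∑-#-+ p q) (∑-mono λ v → pt (p v) (q v) (r v) (h v))
  where
  pt : ∀ a b c → (T c → T a ⊎ T b) → bit c ≤ bit a + bit b
  pt _     _     false _ = z≤n
  pt true  b     true  _ = s≤s z≤n
  pt false true  true  _ = ≤-refl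
  pt false false true  h = ⊥-elim ([ id , id ]′ (h tt))

#-cong : ∀ {n} {p q : BSet n} → p ⊆ᵇ q → q ⊆ᵇ p → # p ≡ # q
#-cong h₁ h₂ = ≤-antisym (#-mono h₁) (#-mono h₂)

#-suc : ∀ {n} (p : BSet (suc n)) → # p ≡ bit (p zero) + # (p ∘ suc)
#-suc p = trans (#-def p) (cong (bit (p zero) +_) (sym (#-def (p ∘ suc))))

#-zero : (p : BSet 0) → # p ≡ 0
#-zero = #-def

#-full : ∀ {n} → # (fullᵇ {n}) ≡ n
#-full {zero}  = #-zero fullᵇ
#-full {suc n} = trans (#-suc fullᵇ) (cong suc (#-full {n}))

#≤n : ∀ {n} (p : BSet n) → # p ≤ n
#≤n {n} p = subst (# p ≤_) (#-full {n}) (#-mono {q = fullᵇ} (λ _ _ → tt))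

T⊎T-not : ∀ b → T b ⊎ T (not b)
T⊎T-not true  = inj₁ tt
T⊎T-not false = inj₂ tt

#-split : ∀ {n} (p q : BSet n) → # p ≡ # (p ∩ᵇ q) + # (p ∩ᵇ ∁ᵇ q)
#-split p q = ≤-antisym
  (#-cover λ v h → [ (λ x → inj₁ (∈∩⁺ h x)) , (λ x → inj₂ (∈∩⁺ h x)) ]′ (T⊎T-not (q v)))
  (#-disjoint {p = p ∩ᵇ q} {q = p ∩ᵇ ∁ᵇ q} (λ v h → proj₁ (∈∩⁻ h)) (λ v h → proj₁ (∈∩⁻ h))
    (λ v h h′ → T-not⇒¬T (proj₂ (∈∩⁻ {p v} h′)) (proj₂ (∈∩⁻ {p v} h))))

#-∁ : ∀ {n} (p : BSet n) → # p + # (∁ᵇ p) ≡ n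
#-∁ {n} p = trans (sym (#-split fullᵇ p)) #-full

⁅_⁆ : ∀ {n} → Fin n → BSet n
⁅ v ⁆ w = ⌊ w ≟ v ⌋

∈⁅⁆ : ∀ {n} (v : Fin n) → v ∈ᵇ ⁅ v ⁆
∈⁅⁆ v = fromWitness refl

∈⁅⁆⁻ : ∀ {n} {v w : Fin n} → w ∈ᵇ ⁅ v ⁆ → w ≡ v
∈⁅⁆⁻ = toWitness

#-⊥ : ∀ {n} {p : BSet n} → (∀ v → v ∉ᵇ p) → # p ≡ 0
#-⊥ {zero}  {p} h = #-zero p
#-⊥ {suc n} {p} h = trans (#-suc p) (cong₂ _+_ (bit-¬T (h zero)) (#-⊥ {p = p ∘ suc} (h ∘ suc)))

#-⁅⁆ : ∀ {n} (v : Fin n) → # ⁅ v ⁆ ≡ 1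
#-⁅⁆ zero    = trans (#-suc ⁅ zero ⁆)
    (cong suc (#-⊥ {p = ⁅ zero ⁆ ∘ suc} λ v h → case ∈⁅⁆⁻ {v = zero} {w = suc v} h of λ ()))
#-⁅⁆ (suc v) = trans (#-suc ⁅ suc v ⁆) (trans
  (#-cong {p = ⁅ suc v ⁆ ∘ suc} {q = ⁅ v ⁆} (λ w h → fromWitness (F.suc-injective (toWitness h)))
      (λ w h → fromWitness (cong suc (toWitness h))))
  (#-⁅⁆ v))

#-pick : ∀ {n} {p q : BSet n} → # q < # p → ∃ λ v → v ∈ᵇ p × v ∉ᵇ q
#-pick {p = p} {q} lt with any? (λ v → T? (p v) ×-dec ¬? (T? (q v)))
... | yes r = r
... | no ¬r = ⊥-elim (<⇒≱ lt (#-mono λ v h → decidable-stable (T? (q v)) λ nq → ¬r (v , h , nq)))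

#-nonempty : ∀ {n} {p : BSet n} → 1 ≤ # p → ∃ λ v → v ∈ᵇ p
#-nonempty {p = p} h with #-pick {p = p} {q = λ _ → false} (subst (_< # p) (sym (#-⊥ {p = λ _ → false} λ _ ())) h)
... | v , i , _ = v , i

#-another : ∀ {n} {p : BSet n} (v : Fin n) → 2 ≤ # p → ∃ λ w → w ∈ᵇ p × w ≢ v
#-another {p = p} v h with #-pick {p = p} {q = ⁅ v ⁆} (subst (_< # p) (sym (#-⁅⁆ v)) h)
... | w , i , j = w , i , λ e → j (fromWitness e)

#-insert : ∀ {n} {p : BSet n} {v} → v ∉ᵇ p → # (p ∪ᵇ ⁅ v ⁆) ≡ suc (# p)
#-insert {p = p} {v} h = ≤-antisym
  (subst (# (p ∪ᵇ ⁅ v ⁆) ≤_) e (#-cover {p = p} {q = ⁅ v ⁆} λ w → ∈∪⁻))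
  (subst (_≤ # (p ∪ᵇ ⁅ v ⁆)) e (#-disjoint {p = p} {q = ⁅ v ⁆} (λ w → ∈∪ˡ) (λ w → ∈∪ʳ {p w})
    λ w i j → h (subst (_∈ᵇ p) (∈⁅⁆⁻ j) i)))
  where
  e : # p + # ⁅ v ⁆ ≡ suc (# p)
  e = trans (cong (# p +_) (#-⁅⁆ v)) (+-comm (# p) 1)

-- Produces test sets for cyclability with prescribed members: P is forced in, Q is the reservoir.
-- Vertices of Q are added one at a time, `d` counting those still to come.
#-choose : ∀ {n} (P Q : BSet n) m → P ⊆ᵇ Q → # P ≤ m → m ≤ # Q →
  ∃ λ X → P ⊆ᵇ X × X ⊆ᵇ Q × # X ≡ m
#-choose P Q m P⊆Q P≤m m≤Q with m≤n⇒∃[o]m+o≡n P≤m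
... | d , e = go d P P⊆Q e
  where
  go : ∀ d P′ → P′ ⊆ᵇ Q → # P′ + d ≡ m → ∃ λ X → P′ ⊆ᵇ X × X ⊆ᵇ Q × # X ≡ m
  go zero    P′ s e = P′ , (λ _ → id) , s , trans (sym (+-identityʳ _)) e
  go (suc d) P′ s e
    with #-pick {p = Q} {q = P′} (<-≤-trans (subst (# P′ <_) e (m<m+n (# P′) (s≤s z≤n))) m≤Q)
  ... | v , v∈ , v∉
    with go d (P′ ∪ᵇ ⁅ v ⁆)
            (λ w i → [ s w , (λ j → subst (_∈ᵇ Q) (sym (∈⁅⁆⁻ j)) v∈) ]′ (∈∪⁻ i))
            (trans (cong (_+ d) (#-insert {p = P′} v∉)) (trans (sym (+-suc (# P′) d)) e))
  ... | X , a , b , c = X , (λ w i → a w (∈∪ˡ i)) , b , c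

#-choose-⊆ : ∀ {n} (Q : BSet n) m → m ≤ # Q → ∃ λ X → X ⊆ᵇ Q × # X ≡ m
#-choose-⊆ Q m h =
  let X , _ , X⊆Q , e = #-choose (λ _ → false) Q m (λ _ ()) (≤-trans (≤-reflexive (#-⊥ {p = λ _ → false} λ _ ())) z≤n) h
  in X , X⊆Q , e

module _ {n : ℕ} where
  open import Data.List.Membership.DecPropositional (_≟_ {n}) using (_∈?_)

  opaque
    mem : List (Fin n) → BSet n
    mem L v = ⌊ v ∈? L ⌋

    mem⁺ : ∀ {L v} → v ∈ L → v ∈ᵇ mem L
    mem⁺ = fromWitness

    mem⁻ : ∀ {L v} → v ∈ᵇ mem L → v ∈ L
    mem⁻ = toWitness

  ∈-dec : ∀ v L → v ∈ L ⊎ v ∉ L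
  ∈-dec v L with v ∈? L
  ... | yes h = inj₁ h
  ... | no h  = inj₂ h

  -- Translates sums along a list, which window arguments bound, into cardinalities such as degrees.
  #-mem-∩ : ∀ (p : BSet n) {L} → Unique L → sum (map (bit ∘ p) L) ≡ # (p ∩ᵇ mem L)
  #-mem-∩ p {[]} _ = sym (#-⊥ {p = p ∩ᵇ mem []} λ v h → case mem⁻ {[]} {v} (proj₂ (∈∩⁻ {p v} {mem [] v} h)) of λ ())
  #-mem-∩ p {x ∷ L} (x∉ ∷ u) = trans (cong₂ _+_ single (#-mem-∩ p u)) (≤-antisym lo hi)
    where
    single : bit (p x) ≡ # (p ∩ᵇ ⁅ x ⁆)
    single with T? (p x)
    ... | yes h = trans (bit-T h) (sym (trans
      (#-cong (λ v i → proj₂ (∈∩⁻ {p v} i)) (λ v i → ∈∩⁺ (subst (_∈ᵇ p) (sym (∈⁅⁆⁻ i)) h) i)) (#-⁅⁆ x)))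
    ... | no h = trans (bit-¬T h) (sym (#-⊥ λ v i →
      let a , b = ∈∩⁻ {p v} i in h (subst (_∈ᵇ p) (∈⁅⁆⁻ b) a)))
    lo : # (p ∩ᵇ ⁅ x ⁆) + # (p ∩ᵇ mem L) ≤ # (p ∩ᵇ mem (x ∷ L))
    lo = #-disjoint
      (λ v i → let a , b = ∈∩⁻ {p v} i in ∈∩⁺ a (mem⁺ (here (∈⁅⁆⁻ b))))
      (λ v i → let a , b = ∈∩⁻ {p v} i in ∈∩⁺ a (mem⁺ (there (mem⁻ {L} b))))
      (λ v i j → All¬⇒¬Any x∉ (subst (_∈ L) (∈⁅⁆⁻ (proj₂ (∈∩⁻ {p v} i))) (mem⁻ {L} (proj₂ (∈∩⁻ {p v} j)))))
    hi : # (p ∩ᵇ mem (x ∷ L)) ≤ # (p ∩ᵇ ⁅ x ⁆) + # (p ∩ᵇ mem L)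
    hi = #-cover λ v i → let a , b = ∈∩⁻ {p v} i in case mem⁻ {x ∷ L} b of λ
      { (here e)  → inj₁ (∈∩⁺ a (fromWitness e))
      ; (there m) → inj₂ (∈∩⁺ a (mem⁺ m)) }

  #-mem : ∀ {L} → Unique L → # (mem L) ≡ length L
  #-mem {L} u = sym (trans (len L) (trans (#-mem-∩ fullᵇ u) (#-cong {p = fullᵇ ∩ᵇ mem L} (λ _ → id) (λ _ → id))))
    where
    len : ∀ L → length L ≡ sum (map (λ (_ : Fin n) → 1) L)
    len []      = refl
    len (x ∷ L) = cong suc (len L)

  unique-length≤ : ∀ {L} {p : BSet n} → Unique L → (∀ {v} → v ∈ L → v ∈ᵇ p) → length L ≤ # p
  unique-length≤ {L} u h = subst (_≤ _) (#-mem u) (#-mono {p = mem L} λ v i → h (mem⁻ {L} i))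

toSubset : ∀ {n} → BSet n → Sub.Subset n
toSubset = tabulate

∣toSubset∣ : ∀ {n} (p : BSet n) → Sub.∣ toSubset p ∣ ≡ # p
∣toSubset∣ {zero}  p = sym (#-zero p)
∣toSubset∣ {suc n} p with p zero | #-suc p
... | true  | e = trans (cong suc (∣toSubset∣ (p ∘ suc))) (sym e)
... | false | e = trans (∣toSubset∣ (p ∘ suc)) (sym e)

∈-toSubset⁺ : ∀ {n} {p : BSet n} {v} → v ∈ᵇ p → v Sub.∈ toSubset p
∈-toSubset⁺ {p = p} {v} h =
  V.lookup⇒[]= v (tabulate p) (trans (V.lookup∘tabulate p v) (Equivalence.to T-≡ h))

∈ᵇ-lookup : ∀ {n} (S : Sub.Subset n) {v} → v Sub.∈ S → v ∈ᵇ lookup S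
∈ᵇ-lookup S {v} h = Equivalence.from T-≡ (V.[]=⇒lookup h)

#-lookup : ∀ {n} (S : Sub.Subset n) → # (lookup S) ≡ Sub.∣ S ∣
#-lookup S = trans (sym (∣toSubset∣ (lookup S))) (cong Sub.∣_∣ (V.tabulate∘lookup S))

-- Cyclic windows: sums over all rotations of a list

module _ {A : Set} where

  rot : List A → List A
  rot []      = []
  rot (x ∷ L) = L ++ x ∷ []

  rotate : ℕ → List A → List A
  rotate zero    L = L
  rotate (suc m) L = rotate m (rot L)

  rotate-++ : ∀ B C → rotate (length B) (B ++ C) ≡ C ++ B
  rotate-++ []      C = sym (L.++-identityʳ C)
  rotate-++ (b ∷ B) C = begin
    rotate (length B) ((B ++ C) ++ b ∷ []) ≡⟨ cong (rotate (length B)) (L.++-assoc B C _) ⟩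
    rotate (length B) (B ++ C ++ b ∷ [])   ≡⟨ rotate-++ B _ ⟩
    (C ++ b ∷ []) ++ B                     ≡⟨ L.++-assoc C _ B ⟩
    C ++ b ∷ B                             ∎
    where open ≡-Reasoning

  rotate-length : ∀ L → rotate (length L) L ≡ L
  rotate-length L = trans (cong (rotate (length L)) (sym (L.++-identityʳ L))) (rotate-++ L [])

  -- Single rotations generate all cyclic shifts, so a property stable under one of them can be
  -- carried to any starting vertex.
  rotate-closed : (P : List A → Set) → (∀ {L} → P L → P (rot L)) → ∀ B C → P (B ++ C) → P (C ++ B)
  rotate-closed P r B C h = subst P (rotate-++ B C) (go (length B) h)
    where
    go : ∀ m {L} → P L → P (rotate m L)
    go zero    h = h
    go (suc m) h = go m (r h)

  rotSum : ℕ → (List A → ℕ) → List A → ℕ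
  rotSum zero    f L = 0
  rotSum (suc m) f L = f L + rotSum m f (rot L)

  rotSum-snoc : ∀ m f L → rotSum (suc m) f L ≡ rotSum m f L + f (rotate m L)
  rotSum-snoc zero    f L = +-comm (f L) 0
  rotSum-snoc (suc m) f L =
    trans (cong (f L +_) (rotSum-snoc m f (rot L))) (sym (+-assoc (f L) _ _))

  rotSum-∘ : ∀ m f L → rotSum m (f ∘ rot) L ≡ rotSum m f (rot L)
  rotSum-∘ zero    f L = refl
  rotSum-∘ (suc m) f L = cong (f (rot L) +_) (rotSum-∘ m f (rot L))

  -- Starting one step later drops the summand `f L` and regains it at the end, because a full turn
  -- returns to L.
  rotSum-shift : ∀ f L → rotSum (length L) (f ∘ rot) L ≡ rotSum (length L) f L
  rotSum-shift f L = trans (rotSum-∘ (length L) f L) (+-cancelˡ-≡ (f L) _ _ (begin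
    f L + rotSum (length L) f (rot L)                 ≡⟨ rotSum-snoc (length L) f L ⟩
    rotSum (length L) f L + f (rotate (length L) L)   ≡⟨ cong (λ z → rotSum (length L) f L + f z) (rotate-length L) ⟩
    rotSum (length L) f L + f L                       ≡⟨ +-comm _ (f L) ⟩
    f L + rotSum (length L) f L                       ∎))
    where open ≡-Reasoning

  rotSum-+ : ∀ m f g L → rotSum m (λ z → f z + g z) L ≡ rotSum m f L + rotSum m g L
  rotSum-+ zero    f g L = refl
  rotSum-+ (suc m) f g L rewrite rotSum-+ m f g (rot L) = lem (f L) (g L) _ _
    where
    lem : ∀ a b c d → a + b + (c + d) ≡ a + c + (b + d)
    lem = solve-∀

  headVal : (A → ℕ) → List A → ℕ
  headVal f []      = 0
  headVal f (x ∷ _) = f x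

  rotSum-head : ∀ f L → rotSum (length L) (headVal f) L ≡ sum (map f L)
  rotSum-head f L = trans (cong (rotSum (length L) (headVal f)) (sym (L.++-identityʳ L))) (go L [])
    where
    go : ∀ B C → rotSum (length B) (headVal f) (B ++ C) ≡ sum (map f B)
    go []      C = refl
    go (b ∷ B) C = cong (f b +_)
      (trans (cong (rotSum (length B) (headVal f)) (L.++-assoc B C _)) (go B _))

  rotSum-≤ : (P : List A → Set) → (∀ {L} → P L → P (rot L)) → ∀ f b → (∀ {L} → P L → f L ≤ b) →
    ∀ m {L} → P L → rotSum m f L ≤ m * b
  rotSum-≤ P r f b h zero    p = z≤n
  rotSum-≤ P r f b h (suc m) p = +-mono-≤ (h p) (rotSum-≤ P r f b h m (r p))

  rotSum-cong : (P : List A → Set) → (∀ {L} → P L → P (rot L)) → ∀ f g → (∀ {L} → P L → f L ≡ g L) →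
    ∀ m {L} → P L → rotSum m f L ≡ rotSum m g L
  rotSum-cong P r f g h zero    p = refl
  rotSum-cong P r f g h (suc m) p = cong₂ _+_ (h p) (rotSum-cong P r f g h m (r p))

  window : ℕ → (A → ℕ) → List A → ℕ
  window zero    f L = 0
  window (suc m) f L = headVal f L + window m f (rot L)

  -- Double counting: during a full turn, the windows of length m meet each position m times.
  rotSum-window : ∀ m f L → rotSum (length L) (window m f) L ≡ m * sum (map f L)
  rotSum-window zero    f L = go (length L) L
    where
    go : ∀ k L → rotSum k (λ _ → 0) L ≡ 0
    go zero    L = refl
    go (suc k) L = go k (rot L)
  rotSum-window (suc m) f L = trans (rotSum-+ (length L) (headVal f) (window m f ∘ rot) L)
    (cong₂ _+_ (rotSum-head f L) (trans (rotSum-shift (window m f) L) (rotSum-window m f L)))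

  -- Averaging turns a local bound on each window into a bound on the sum along L. The invariant P,
  -- typically being a rotation of a fixed cycle, is what the local bound is derived from.
  window-bound : (P : List A → Set) → (∀ {L} → P L → P (rot L)) → ∀ w f b →
    (∀ {L} → P L → window w f L ≤ b) → ∀ {L} → P L → w * sum (map f L) ≤ length L * b
  window-bound P r w f b h {L} p =
    subst (_≤ length L * b) (rotSum-window w f L) (rotSum-≤ P r (window w f) b h (length L) p)

-- Duplicate-free lists

module _ {A : Set} where

  unique-resp-↭ : ∀ {xs ys : List A} → xs ↭ ys → Unique xs → Unique ys
  unique-resp-↭ p = PS.Unique-resp-↭ (≡P.setoid A) (↭⇒↭ₛ p)

  unique-++⁻ : ∀ (xs : List A) {ys} → Unique (xs ++ ys) →
    Unique xs × Unique ys × (∀ {v} → v ∈ xs → v ∉ ys)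
  unique-++⁻ []       u        = [] , u , λ ()
  unique-++⁻ (x ∷ xs) (x∉ ∷ u) with unique-++⁻ xs u
  ... | a , b , d = All.tabulate (λ i → All.lookup x∉ (∈-++⁺ˡ i)) ∷ a , b , λ
    { (here refl) j → All.lookup x∉ (∈-++⁺ʳ xs j) refl
    ; (there i)   j → d i j }

  unique-++⁺ : ∀ {xs ys : List A} → Unique xs → Unique ys → (∀ {v} → v ∈ xs → v ∉ ys) → Unique (xs ++ ys)
  unique-++⁺ a b d = U.++⁺ a b λ (i , j) → d i j

  unique-∉ : ∀ {x : A} {xs} → Unique (x ∷ xs) → x ∉ xs
  unique-∉ (h ∷ _) = All¬⇒¬Any h

  unique-tail : ∀ {x : A} {xs} → Unique (x ∷ xs) → Unique xs
  unique-tail (_ ∷ u) = u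

  unique-∷ : ∀ {x : A} {xs} → x ∉ xs → Unique xs → Unique (x ∷ xs)
  unique-∷ h u = ¬Any⇒All¬ _ h ∷ u

  ∷≡++ : ∀ (x : A) xs → ∃₂ λ ys y → x ∷ xs ≡ ys ++ y ∷ []
  ∷≡++ x []       = [] , x , refl
  ∷≡++ x (z ∷ xs) with ∷≡++ z xs
  ... | ys , y , e = x ∷ ys , y , cong (x ∷_) e

-- Walks, cycles, rotations and rerouting

module Cycles {n : ℕ} (G : Graph n) where

  infix 4 _~_

  _~_ : Fin n → Fin n → Set
  _~_ = Adj G

  ~-sym : ∀ {u v} → u ~ v → v ~ u
  ~-sym {u} {v} = subst T (adj-sym G u v)

  ~-irrefl : ∀ {v} → ¬ v ~ v
  ~-irrefl {v} h = subst T (irrefl G v) h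

  ~⇒≢ : ∀ {u v} → u ~ v → u ≢ v
  ~⇒≢ h refl = ~-irrefl h

  data Walk : Fin n → Fin n → List (Fin n) → Set where
    single : ∀ a → Walk a a (a ∷ [])
    _∷ʷ_   : ∀ {a b c L} → a ~ b → Walk b c L → Walk a c (a ∷ L)

  infixr 5 _∷ʷ_

  walk-head : ∀ {a b x L} → Walk a b (x ∷ L) → a ≡ x
  walk-head (single a) = refl
  walk-head (_ ∷ʷ _)   = refl

  walk-∷ : ∀ {a b L} → Walk a b L → ∃ λ M → L ≡ a ∷ M
  walk-∷ (single a)        = [] , refl
  walk-∷ (_∷ʷ_ {L = M} _ _) = M , refl

  walk-++ : ∀ {a b c d L M} → Walk a b L → b ~ c → Walk c d M → Walk a d (L ++ M)
  walk-++ (single a) e w′ = e ∷ʷ w′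
  walk-++ (e′ ∷ʷ w)  e w′ = e′ ∷ʷ walk-++ w e w′

  walk-suffix : ∀ {a b c} L {M} → Walk a b (L ++ c ∷ M) → Walk c b (c ∷ M)
  walk-suffix []          w           = subst (λ z → Walk z _ _) (walk-head w) w
  walk-suffix (x ∷ [])    (_ ∷ʷ w)    = walk-suffix [] w
  walk-suffix (x ∷ y ∷ L) (_ ∷ʷ w)    = walk-suffix (y ∷ L) w

  walk-prefix : ∀ {a b x c} L {M} → Walk a b (x ∷ L ++ c ∷ M) →
    ∃ λ y → Walk a y (x ∷ L) × y ~ c
  walk-prefix {x = x} [] (e ∷ʷ w) = x , single x , subst (x ~_) (walk-head w) e
  walk-prefix (z ∷ L) (e ∷ʷ w) with walk-prefix L w
  ... | y , w′ , e′ = y , e ∷ʷ w′ , e′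

  walk-last : ∀ {a b y} L → Walk a b (L ++ y ∷ []) → b ≡ y
  walk-last []          (single _) = refl
  walk-last (x ∷ [])    (_ ∷ʷ w)   = walk-last [] w
  walk-last (x ∷ z ∷ L) (_ ∷ʷ w)   = walk-last (z ∷ L) w

  walk-reverse : ∀ {a b L} → Walk a b L → Walk b a (reverse L)
  walk-reverse (single a) = single a
  walk-reverse (_∷ʷ_ {a} {L = L} e w) =
    subst (Walk _ a) (sym (L.unfold-reverse a L)) (walk-++ (walk-reverse w) (~-sym e) (single a))

  walk⇒linked : ∀ {a b y L} → Walk a b L → b ~ y → Linked _~_ (L ++ y ∷ [])
  walk⇒linked (single a)           e = e ∷ [-]
  walk⇒linked (e′ ∷ʷ w@(single _)) e = e′ ∷ walk⇒linked w e
  walk⇒linked (e′ ∷ʷ w@(_ ∷ʷ _))   e = e′ ∷ walk⇒linked w e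

  linked⇒walk : ∀ {y} x L → Linked _~_ (x ∷ L ++ y ∷ []) → ∃ λ z → Walk x z (x ∷ L) × z ~ y
  linked⇒walk x []      (e ∷ _) = x , single x , e
  linked⇒walk x (z ∷ L) (e ∷ l) with linked⇒walk z L l
  ... | b , w , e′ = b , e ∷ʷ w , e′

  walk⇒cycle : ∀ {a b L} → Walk a b L → b ~ a → Unique L → 3 ≤ length L → IsCycle G L
  walk⇒cycle w e u l with walk-∷ w
  ... | M , refl = l , u , walk⇒linked w e

  cycle⇒walk : ∀ {x L} → IsCycle G (x ∷ L) → ∃ λ z → Walk x z (x ∷ L) × z ~ x
  cycle⇒walk {x} {L} (_ , _ , l) = linked⇒walk x L l

  cycle-unique : ∀ {L} → IsCycle G L → Unique L
  cycle-unique {_ ∷ _} (_ , u , _) = u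

  cycle-length : ∀ {L} → IsCycle G L → 3 ≤ length L
  cycle-length {_ ∷ _} (l , _ , _) = l

  rot-↭ : ∀ (L : List (Fin n)) → rot L ↭ L
  rot-↭ []      = ↭-refl
  rot-↭ (x ∷ L) = ++-comm L (x ∷ [])

  cycle-rot : ∀ {L} → IsCycle G L → IsCycle G (rot L)
  cycle-rot {x ∷ []} c = c
  cycle-rot {x ∷ y ∷ L} c with cycle⇒walk c
  ... | z , e ∷ʷ w , e′ with walk-head w
  ... | refl = walk⇒cycle (walk-++ w e′ (single x)) e
    (unique-resp-↭ (↭-sym (rot-↭ (x ∷ y ∷ L))) (cycle-unique c))
    (subst (3 ≤_) (sym (↭-length (rot-↭ (x ∷ y ∷ L)))) (cycle-length c))

  -- The arc `M` between u and v gives way to a path off the cycle. Since P is nonempty, at least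
  -- three vertices remain. With `M` empty this inserts P into an edge.
  bypass : ∀ {u v x y} M B {P} → IsCycle G (u ∷ M ++ v ∷ B) → Walk x y P → Unique P →
    (∀ {z} → z ∈ P → z ∉ u ∷ M ++ v ∷ B) → u ~ x → y ~ v → IsCycle G (u ∷ P ++ v ∷ B)
  bypass {u} {v} M B {P} c w uP disj e₁ e₂ with cycle⇒walk c
  ... | z , wc , e = walk⇒cycle (e₁ ∷ʷ walk-++ w e₂ (walk-suffix (u ∷ M) wc)) e
    (unique-resp-↭ (shift u P (v ∷ B)) (unique-++⁺ uP uR
      λ i j → disj i (∈-resp-↭ (shift u M (v ∷ B)) (∈-++⁺ʳ M j))))
    (len (walk-∷ w))
    where
    uR : Unique (u ∷ v ∷ B)
    uR = proj₁ (proj₂ (unique-++⁻ M (unique-resp-↭ (↭-sym (shift u M (v ∷ B))) (cycle-unique c))))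
    len : ∀ {x P} → (∃ λ M → P ≡ x ∷ M) → 3 ≤ length (u ∷ P ++ v ∷ B)
    len (M , refl) rewrite L.length-++ M {v ∷ B} = s≤s (s≤s (≤-trans (s≤s z≤n) (m≤n+m _ (length M))))

  cross-↭ : ∀ (d₁ w₁ d₂ w₂ x : Fin n) A B →
    d₁ ∷ x ∷ d₂ ∷ reverse (w₁ ∷ A) ++ w₂ ∷ B ↭ x ∷ d₁ ∷ w₁ ∷ A ++ d₂ ∷ w₂ ∷ B
  cross-↭ d₁ w₁ d₂ w₂ x A B = ↭-swap d₁ x (↭-trans
    (↭-prep d₂ (++⁺ʳ (w₂ ∷ B) (↭-reverse (w₁ ∷ A)))) (↭-sym (shift d₂ (w₁ ∷ A) (w₂ ∷ B))))

  -- The new cycle goes from d₁ through x to d₂, runs back along the old arc to w₁, takes the chord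
  -- to w₂ and follows the old cycle home. It gains exactly the vertex x.
  crossing : ∀ {d₁ w₁ d₂ w₂ x} A B → IsCycle G (d₁ ∷ w₁ ∷ A ++ d₂ ∷ w₂ ∷ B) →
    x ∉ d₁ ∷ w₁ ∷ A ++ d₂ ∷ w₂ ∷ B → x ~ d₁ → x ~ d₂ → w₁ ~ w₂ →
    IsCycle G (d₁ ∷ x ∷ d₂ ∷ reverse (w₁ ∷ A) ++ w₂ ∷ B)
  crossing {d₁} {w₁} {d₂} {w₂} {x} A B c x∉ e₁ e₂ e₃ with cycle⇒walk c
  ... | z , (_∷ʷ_ {b = b} e w) , ez with walk-head w
  ... | refl with walk-prefix A w
  ... | y , wA , ey = walk⇒cycle
    (~-sym e₁ ∷ʷ e₂ ∷ʷ ~-sym ey ∷ʷ walk-++ (walk-reverse wA) e₃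
        (walk-suffix (w₁ ∷ A ++ d₂ ∷ []) (subst (Walk w₁ z) (cong (w₁ ∷_) (sym (L.++-assoc A _ _))) w)))
    ez
    (unique-resp-↭ (↭-sym (cross-↭ d₁ w₁ d₂ w₂ x A B)) (unique-∷ x∉ (cycle-unique c)))
    (s≤s (s≤s (s≤s z≤n)))

  lastOf : Fin n → List (Fin n) → Fin n
  lastOf p []      = p
  lastOf p (a ∷ L) = lastOf a L

  predFrom : Fin n → List (Fin n) → Fin n → Fin n
  predFrom p []      w = w
  predFrom p (a ∷ L) w with w ≟ a
  ... | yes _ = p
  ... | no _  = predFrom a L w

  -- The vertex before w on the cycle L; the junk value w if w is not on L.
  pred : List (Fin n) → Fin n → Fin n
  pred []      w = w
  pred (h ∷ t) w = predFrom (lastOf h t) (h ∷ t) w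

  lastOf-++ : ∀ p L a → lastOf p (L ++ a ∷ []) ≡ a
  lastOf-++ p []      a = refl
  lastOf-++ p (x ∷ L) a = lastOf-++ x L a

  predFrom-here : ∀ p L w → predFrom p (w ∷ L) w ≡ p
  predFrom-here p L w with w ≟ w
  ... | yes _ = refl
  ... | no ne = ⊥-elim (ne refl)

  predFrom-there : ∀ p a L w → w ≢ a → predFrom p (a ∷ L) w ≡ predFrom a L w
  predFrom-there p a L w ne with w ≟ a
  ... | yes e = ⊥-elim (ne e)
  ... | no _  = refl

  predFrom-mid : ∀ p L a w M → w ∉ L ++ a ∷ [] → predFrom p (L ++ a ∷ w ∷ M) w ≡ a
  predFrom-mid p [] a w M h =
    trans (predFrom-there p a _ w λ e → h (here e)) (predFrom-here a M w)
  predFrom-mid p (x ∷ L) a w M h =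
    trans (predFrom-there p x _ w λ e → h (here e)) (predFrom-mid x L a w M λ i → h (there i))

  predFrom-++ˡ : ∀ p L M w → w ∈ L → predFrom p (L ++ M) w ≡ predFrom p L w
  predFrom-++ˡ p (a ∷ L) M w i with w ≟ a
  ... | yes _ = refl
  ... | no ne with i
  ... | here e  = ⊥-elim (ne e)
  ... | there j = predFrom-++ˡ a L M w j

  predFrom-end : ∀ p L w → w ∉ L → predFrom p (L ++ w ∷ []) w ≡ lastOf p L
  predFrom-end p []      w h = predFrom-here p [] w
  predFrom-end p (a ∷ L) w h =
    trans (predFrom-there p a _ w λ e → h (here e)) (predFrom-end a L w λ i → h (there i))

  -- Two entries are affected: the predecessor of the old head lay across the seam and becomes its
  -- left neighbour, and for the new head the reverse happens.
  pred-rot : ∀ {L w} → Unique L → w ∈ L → pred (rot L) w ≡ pred L w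
  pred-rot {a ∷ []}    u i = refl
  pred-rot {a ∷ b ∷ t} {w} u i with w ≟ a
  ... | yes refl = trans (predFrom-end (lastOf b (t ++ a ∷ [])) (b ∷ t) a (unique-∉ u)) refl
  ... | no ne with i
  ... | here e  = ⊥-elim (ne e)
  ... | there j = trans (cong (λ p → predFrom p (b ∷ t ++ a ∷ []) w) (lastOf-++ b t a))
                        (predFrom-++ˡ a (b ∷ t) (a ∷ []) w j)

  -- A rotation of D, recorded through its invariants. The field `prd` allows successors to be
  -- computed in whichever rotation is convenient.
  record Turn (D L : List (Fin n)) : Set where
    field
      cycle : IsCycle G L
      sub   : ∀ {v} → v ∈ L → v ∈ D
      sup   : ∀ {v} → v ∈ D → v ∈ L
      len   : length L ≡ length D
      prd   : ∀ {w} → w ∈ D → pred L w ≡ pred D w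

  open Turn

  turn-refl : ∀ {D} → IsCycle G D → Turn D D
  turn-refl c = record { cycle = c ; sub = id ; sup = id ; len = refl ; prd = λ _ → refl }

  turn-rot : ∀ {D L} → Turn D L → Turn D (rot L)
  turn-rot {D} {L} t = record
    { cycle = cycle-rot (cycle t)
    ; sub   = λ i → sub t (∈-resp-↭ (rot-↭ L) i)
    ; sup   = λ i → ∈-resp-↭ (↭-sym (rot-↭ L)) (sup t i)
    ; len   = trans (↭-length (rot-↭ L)) (len t)
    ; prd   = λ i → trans (pred-rot (cycle-unique (cycle t)) (sup t i)) (prd t i) }

  turn-to : ∀ {D v} → IsCycle G D → v ∈ D → ∃ λ M → Turn D (v ∷ M)
  turn-to {D} {v} c i with ∈-∃++ i
  ... | B , C , refl = C ++ B , rotate-closed (Turn D) turn-rot B (v ∷ C) (turn-refl c)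

  turn-pred : ∀ {D w} → IsCycle G D → w ∈ D → ∃ λ M → Turn D (pred D w ∷ w ∷ M)
  turn-pred {D} {w} c i with turn-to c i
  ... | [] , t with cycle-length (cycle t)
  ... | s≤s ()
  -- With w in front, its cyclic predecessor is the last entry; one more shift brings that entry
  -- before w.
  turn-pred {D} {w} c i | a ∷ M , t with ∷≡++ a M
  ... | L , d , e rewrite e = L , subst (λ z → Turn D (z ∷ w ∷ L)) pe t′
    where
    t′ : Turn D (d ∷ w ∷ L)
    t′ = rotate-closed (Turn D) turn-rot (w ∷ L) (d ∷ []) t
    w≢d : w ≢ d
    w≢d refl = unique-∉ (cycle-unique (cycle t′)) (here refl)
    pe : d ≡ pred D w
    pe = trans (sym (trans (predFrom-there (lastOf w L) d (w ∷ L) w w≢d) (predFrom-here d L w))) (prd t′ i)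

  -- Maximality is with respect to inclusion of vertex sets, not length.
  Max : List (Fin n) → Set
  Max L = IsCycle G L × (∀ C → IsCycle G C → length L < length C → (∀ {v} → v ∈ L → v ∈ C) → ⊥)

  max-turn : ∀ {D L} → Max D → Turn D L → Max L
  max-turn (_ , m) t = cycle t , λ C c l h →
    m C c (subst (_< length C) (len t) l) (λ i → h (sup t i))

  max-insert : ∀ {u v x y B P} → Max (u ∷ v ∷ B) → Walk x y P → Unique P →
    (∀ {z} → z ∈ P → z ∉ u ∷ v ∷ B) → u ~ x → y ~ v → ⊥
  max-insert {u} {v} {B = B} {P} (c , m) w uP disj e₁ e₂ =
    m (u ∷ P ++ v ∷ B) (bypass [] B c w uP disj e₁ e₂) (len′ (walk-∷ w)) λ
      { (here e) → here e ; (there i) → there (∈-++⁺ʳ P i) }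
    where
    len′ : ∀ {x P} → (∃ λ M → P ≡ x ∷ M) → length (u ∷ v ∷ B) < length (u ∷ P ++ v ∷ B)
    len′ (M , refl) rewrite L.length-++ M {v ∷ B} = s≤s (s≤s (m≤n+m _ (length M)))

  max-insert₁ : ∀ {u v x B} → Max (u ∷ v ∷ B) → x ∉ u ∷ v ∷ B → x ~ u → x ~ v → ⊥
  max-insert₁ {x = x} m x∉ e₁ e₂ = max-insert m (single x) ([] ∷ [])
    (λ { (here refl) → x∉ }) (~-sym e₁) e₂

  max-cross : ∀ {d₁ w₁ d₂ w₂ x} A B → Max (d₁ ∷ w₁ ∷ A ++ d₂ ∷ w₂ ∷ B) →
    x ∉ d₁ ∷ w₁ ∷ A ++ d₂ ∷ w₂ ∷ B → x ~ d₁ → x ~ d₂ → w₁ ~ w₂ → ⊥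
  max-cross {d₁} {w₁} {d₂} {w₂} {x} A B (c , m) x∉ e₁ e₂ e₃ =
    m _ (crossing A B c x∉ e₁ e₂ e₃) (≤-reflexive (sym (↭-length p))) (λ i → ∈-resp-↭ (↭-sym p) (there i))
    where
    p = cross-↭ d₁ w₁ d₂ w₂ x A B

-- Neighbours of an outside vertex on a maximal cycle

sum-map-+ : ∀ {A : Set} (f g : A → ℕ) L → sum (map (λ v → f v + g v) L) ≡ sum (map f L) + sum (map g L)
sum-map-+ f g []      = refl
sum-map-+ f g (x ∷ L) rewrite sum-map-+ f g L = lem (f x) (g x) _ _
  where
  lem : ∀ a b c d → a + b + (c + d) ≡ a + c + (b + d)
  lem = solve-∀

-- The bits tell whether the two ends of a path off the cycle are adjacent to one cycle vertex (a,
-- b) and to a later one (a′, b′). Between consecutive vertices even a single end can be inserted;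
-- at larger distance only different ends conflict, as the detour enters the path at one end and
-- leaves at the other.
Separated₁ Separated₂ : (a b a′ b′ : Bool) → Set
Separated₁ a b a′ b′ = (T a → ¬ T a′) × (T b → ¬ T b′) × (T a → ¬ T b′) × (T b → ¬ T a′)
Separated₂ a b a′ b′ = (T a → ¬ T b′) × (T b → ¬ T a′)

window₂≤1 : ∀ a b → (T a → ¬ T b) → bit a + (bit b + 0) ≤ 1
window₂≤1 true  b     h rewrite bit-¬T (h tt) = ≤-refl
window₂≤1 false true  h = ≤-refl
window₂≤1 false false h = z≤n

-- If the first vertex meets one end, the second meets none and the third at most that same end; if
-- it meets both ends, the other two meet none. If it meets none, the second vertex takes its place.
window₃≤2 : ∀ a b a′ b′ a″ b″ → Separated₁ a b a′ b′ → Separated₁ a′ b′ a″ b″ → Separated₂ a b a″ b″ →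
  bit a + bit b + (bit a′ + bit b′ + (bit a″ + bit b″ + 0)) ≤ 2
window₃≤2 true true a′ b′ a″ b″ (f , g , _) _ (h , k)
  rewrite bit-¬T (f tt) | bit-¬T (g tt) | bit-¬T (h tt) | bit-¬T (k tt) = ≤-refl
window₃≤2 true false a′ b′ a″ b″ (f , _ , g , _) _ (h , _)
  rewrite bit-¬T (f tt) | bit-¬T (g tt) | bit-¬T (h tt) | +-identityʳ (bit a″) | +-identityʳ (bit a″) = s≤s (bit≤1 a″)
window₃≤2 false true a′ b′ a″ b″ (_ , g , _ , f) _ (_ , h)
  rewrite bit-¬T (f tt) | bit-¬T (g tt) | bit-¬T (h tt) | +-identityʳ (bit b″) = s≤s (bit≤1 b″)
window₃≤2 false false true true a″ b″ _ (f , g , _) _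
  rewrite bit-¬T (f tt) | bit-¬T (g tt) = ≤-refl
window₃≤2 false false true false a″ b″ _ (f , _ , g , _) _
  rewrite bit-¬T (f tt) | bit-¬T (g tt) = s≤s z≤n
window₃≤2 false false false true a″ b″ _ (_ , g , _ , f) _
  rewrite bit-¬T (f tt) | bit-¬T (g tt) = s≤s z≤n
window₃≤2 false false false false a″ b″ _ _ _
  rewrite +-identityʳ (bit a″ + bit b″) = +-mono-≤ (bit≤1 a″) (bit≤1 b″)

-- If the first vertex meets just one end, only that end can meet the third or the fourth, and not
-- both, as these are consecutive. If it meets none, the bound for three vertices applies.
window₄≤2 : ∀ a b a′ b′ a″ b″ a‴ b‴ →
  Separated₁ a b a′ b′ → Separated₁ a′ b′ a″ b″ → Separated₁ a″ b″ a‴ b‴ →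
  Separated₂ a b a″ b″ → Separated₂ a′ b′ a‴ b‴ → Separated₂ a b a‴ b‴ →
  bit a + bit b + (bit a′ + bit b′ + (bit a″ + bit b″ + (bit a‴ + bit b‴ + 0))) ≤ 2
window₄≤2 false false a′ b′ a″ b″ a‴ b‴ _ s₂ s₃ _ s₅ _ = window₃≤2 a′ b′ a″ b″ a‴ b‴ s₂ s₃ s₅
window₄≤2 true true a′ b′ a″ b″ a‴ b‴ (f , g , _) _ _ (h , k) _ (l , m)
  rewrite bit-¬T (f tt) | bit-¬T (g tt) | bit-¬T (h tt) | bit-¬T (k tt) | bit-¬T (l tt) | bit-¬T (m tt) = ≤-refl
window₄≤2 true false a′ b′ a″ b″ a‴ b‴ (f , _ , g , _) _ (e , _) (h , _) _ (l , _)
  rewrite bit-¬T (f tt) | bit-¬T (g tt) | bit-¬T (h tt) | bit-¬T (l tt) = s≤s (pair a″ a‴ e)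
  where
  pair : ∀ p q → (T p → ¬ T q) → bit p + 0 + (bit q + 0 + 0) ≤ 1
  pair true  q e rewrite bit-¬T (e tt) = ≤-refl
  pair false true  _ = ≤-refl
  pair false false _ = z≤n
window₄≤2 false true a′ b′ a″ b″ a‴ b‴ (_ , g , _ , f) _ (_ , e , _) (_ , h) _ (_ , l)
  rewrite bit-¬T (f tt) | bit-¬T (g tt) | bit-¬T (h tt) | bit-¬T (l tt) = s≤s (window₂≤1 b″ b‴ e)

module Windows {n : ℕ} (G : Graph n) where
  open Cycles G
  open Turn

  onDeg offDeg : Fin n → List (Fin n) → ℕ
  onDeg  x D = # (adj G x ∩ᵇ mem D)
  offDeg x D = # (adj G x ∩ᵇ ∁ᵇ (mem D))

  deg-split : ∀ x D → # (adj G x) ≡ onDeg x D + offDeg x D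
  deg-split x D = #-split (adj G x) (mem D)

  sum-adj : ∀ {D} x → IsCycle G D → sum (map (bit ∘ adj G x) D) ≡ onDeg x D
  sum-adj x c = #-mem-∩ (adj G x) (cycle-unique c)

  -- The set usually written N⁺: the successors along D of the neighbours of x on D.
  succs : Fin n → List (Fin n) → BSet n
  succs x D = (λ w → adj G x (pred D w)) ∩ᵇ mem D

  pred-second : ∀ {d w M} → d ≢ w → pred (d ∷ w ∷ M) w ≡ d
  pred-second {d} {w} {M} ne = trans (predFrom-there _ d (w ∷ M) w (ne ∘ sym)) (predFrom-here d M w)

  -- Taking successors is a bijection of D. In sums over rotations it appears as a shift by one: the
  -- head of a rotation is the predecessor of the next head.
  #-succs : ∀ {D} x → IsCycle G D → # (succs x D) ≡ onDeg x D
  #-succs {D} x c = begin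
    # (succs x D)                           ≡⟨ #-mem-∩ _ (cycle-unique c) ⟨
    sum (map f D)                           ≡⟨ rotSum-head f D ⟨
    rotSum (length D) (headVal f) D         ≡⟨ rotSum-shift (headVal f) D ⟨
    rotSum (length D) (headVal f ∘ rot) D   ≡⟨ rotSum-cong (Turn D) turn-rot _ _ step (length D) (turn-refl c) ⟩
    rotSum (length D) (headVal g) D         ≡⟨ rotSum-head g D ⟩
    sum (map g D)                           ≡⟨ sum-adj x c ⟩
    onDeg x D                               ∎
    where
    open ≡-Reasoning
    g f : Fin n → ℕ
    g = bit ∘ adj G x
    f w = g (pred D w)
    step : ∀ {L} → Turn D L → headVal f (rot L) ≡ headVal g L
    step {[]} t = case cycle t of λ ()
    step {d ∷ []} t = case cycle-length (cycle t) of λ { (s≤s ()) }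
    step {d ∷ w ∷ M} t = cong g (trans (sym (prd t (sub t (there (here refl)))))
      (pred-second {d} {w} {M} λ { refl → unique-∉ (cycle-unique (cycle t)) (here refl) }))

  ∉-turn : ∀ {D L} {x : Fin n} → x ∉ D → Turn D L → x ∉ L
  ∉-turn h t i = h (sub t i)

  ≁-succ : ∀ {D x w} → Max D → x ∉ D → w ∈ᵇ succs x D → ¬ x ~ w
  ≁-succ {D} {x} {w} m x∉ i e with ∈∩⁻ {adj G x (pred D w)} i
  ... | ep , wD with turn-pred (proj₁ m) (mem⁻ wD)
  ... | M , t = max-insert₁ (max-turn m t) (∉-turn x∉ t) ep e

  succ-≁-succ : ∀ {D x w₁ w₂} → Max D → x ∉ D → w₁ ∈ᵇ succs x D → w₂ ∈ᵇ succs x D → ¬ w₁ ~ w₂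
  succ-≁-succ {D} {x} {w₁} {w₂} m x∉ i₁ i₂ e
    with ∈∩⁻ {adj G x (pred D w₁)} i₁ | ∈∩⁻ {adj G x (pred D w₂)} i₂
  ... | e₁ , j₁ | e₂ , j₂ with turn-pred (proj₁ m) (mem⁻ {L = D} j₁)
  ... | M , t with sup t (mem⁻ {L = D} j₂)
  -- Here w₂ directly precedes w₁, so it is both a neighbour of x and a successor; the case where w₂
  -- directly follows w₁ is symmetric. In the remaining case the edge between w₁ and w₂ permits the
  -- crossing.
  ... | here refl = ≁-succ m x∉ i₂ e₁
  ... | there (here refl) = ~-irrefl e
  ... | there (there k) with ∈-∃++ k
  ... | [] , B , refl = ≁-succ m x∉ i₁ (subst (x ~_) p e₂)
    where
    u = cycle-unique (cycle t)
    p : pred D w₂ ≡ w₁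
    p = trans (sym (prd t (mem⁻ {L = D} j₂))) (predFrom-mid _ (pred D w₁ ∷ []) w₁ w₂ B λ
      { (here refl) → unique-∉ u (there (here refl)) ; (there (here refl)) → unique-∉ (unique-tail u) (here refl) })
  ... | a ∷ A , B , refl with ∷≡++ a A
  ... | A′ , d₂ , eq = max-cross A′ B (max-turn m t′) (∉-turn x∉ t′) e₁ (subst (x ~_) p e₂) e
    where
    t′ : Turn D (pred D w₁ ∷ w₁ ∷ A′ ++ d₂ ∷ w₂ ∷ B)
    t′ = subst (λ z → Turn D (pred D w₁ ∷ w₁ ∷ z))
      (trans (cong (_++ w₂ ∷ B) eq) (L.++-assoc A′ (d₂ ∷ []) (w₂ ∷ B))) t
    u : Unique ((pred D w₁ ∷ w₁ ∷ A′ ++ d₂ ∷ []) ++ w₂ ∷ B)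
    u = subst (λ z → Unique (pred D w₁ ∷ w₁ ∷ z)) (sym (L.++-assoc A′ (d₂ ∷ []) (w₂ ∷ B))) (cycle-unique (cycle t′))
    p : pred D w₂ ≡ d₂
    p = trans (sym (prd t′ (mem⁻ {L = D} j₂))) (predFrom-mid _ (pred D w₁ ∷ w₁ ∷ A′) d₂ w₂ B λ k →
      proj₂ (proj₂ (unique-++⁻ (pred D w₁ ∷ w₁ ∷ A′ ++ d₂ ∷ []) u)) k (here refl))

  starSet : Fin n → List (Fin n) → BSet n
  starSet x D = ⁅ x ⁆ ∪ᵇ succs x D

  Independent : BSet n → Set
  Independent p = ∀ u v → u ∈ᵇ p → v ∈ᵇ p → ¬ u ~ v

  starSet-independent : ∀ {D x} → Max D → x ∉ D → Independent (starSet x D)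
  starSet-independent {D} {x} m x∉ u v i j e with ∈∪⁻ {⁅ x ⁆ u} i | ∈∪⁻ {⁅ x ⁆ v} j
  ... | inj₁ a | inj₁ b = ~⇒≢ e (trans (∈⁅⁆⁻ a) (sym (∈⁅⁆⁻ b)))
  ... | inj₁ a | inj₂ b = ≁-succ m x∉ b (subst (_~ v) (∈⁅⁆⁻ a) e)
  ... | inj₂ a | inj₁ b = ≁-succ m x∉ a (subst (_~ u) (∈⁅⁆⁻ b) (~-sym e))
  ... | inj₂ a | inj₂ b = succ-≁-succ m x∉ a b e

  succs⊆ : ∀ {D x w} → w ∈ᵇ succs x D → w ∈ D
  succs⊆ {D} {x} {w} i = mem⁻ {L = D} (proj₂ (∈∩⁻ {adj G x (pred D w)} i))

  #-starSet : ∀ {D x} → IsCycle G D → x ∉ D → # (starSet x D) ≡ suc (onDeg x D)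
  #-starSet {D} {x} c x∉ = trans (≤-antisym
    (#-cover {p = ⁅ x ⁆} {q = succs x D} λ v → ∈∪⁻)
    (#-disjoint {p = ⁅ x ⁆} {q = succs x D} (λ v → ∈∪ˡ) (λ v → ∈∪ʳ {⁅ x ⁆ v})
      λ v a b → x∉ (subst (_∈ D) (∈⁅⁆⁻ a) (succs⊆ b))))
    (cong₂ _+_ (#-⁅⁆ x) (#-succs x c))

  -- No two consecutive vertices of the cycle are in p, so each window of length two contributes at
  -- most one.
  independent-cycle : ∀ {D p} → Independent p → IsCycle G D → 2 * # (p ∩ᵇ mem D) ≤ length D
  independent-cycle {D} {p} ind c = subst₂ _≤_
    (cong (2 *_) (#-mem-∩ p (cycle-unique c))) (*-identityʳ (length D))
    (window-bound (Turn D) turn-rot 2 (bit ∘ p) 1 step (turn-refl c))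
    where
    step : ∀ {L} → Turn D L → window 2 (bit ∘ p) L ≤ 1
    step {[]} t = case cycle t of λ ()
    step {u ∷ []} t = case cycle-length (cycle t) of λ { (s≤s ()) }
    step {u ∷ v ∷ M} t with cycle⇒walk (cycle t)
    ... | _ , e ∷ʷ w , _ = window₂≤1 (p u) (p v) λ a b → ind u v a b (subst (u ~_) (walk-head w) e)

  onDeg-≤ : ∀ {D x} → Max D → x ∉ D → 2 * onDeg x D ≤ length D
  onDeg-≤ {D} {x} m x∉ = subst₂ _≤_
    (cong (2 *_) (sum-adj x (proj₁ m))) (*-identityʳ (length D))
    (window-bound (Turn D) turn-rot 2 (bit ∘ adj G x) 1 step (turn-refl (proj₁ m)))
    where
    step : ∀ {L} → Turn D L → window 2 (bit ∘ adj G x) L ≤ 1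
    step {[]} t = case cycle t of λ ()
    step {u ∷ []} t = case cycle-length (cycle t) of λ { (s≤s ()) }
    step {u ∷ v ∷ M} t = window₂≤1 (adj G x u) (adj G x v) (max-insert₁ (max-turn m t) (∉-turn x∉ t))

  module Ear {D a b P} (m : Max D) (w : Walk a b P) (uP : Unique P) (disj : ∀ {z} → z ∈ P → z ∉ D)
             {c} (c-bound : ∀ C → IsCycle G C → length C ≤ c) where

    rP = reverse P

    r-walk : Walk b a rP
    r-walk = walk-reverse w

    r-unique : Unique rP
    r-unique = unique-resp-↭ (↭-sym (↭-reverse P)) uP

    r-disj : ∀ {z} → z ∈ rP → z ∉ D
    r-disj i = disj (∈-resp-↭ (↭-reverse P) i)

    a∉ : a ∉ D
    a∉ with walk-∷ w
    ... | _ , refl = disj (here refl)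

    b∉ : b ∉ D
    b∉ with rP | r-walk | r-disj
    ... | _ | rw | rd with walk-∷ rw
    ... | _ , refl = rd (here refl)

    gap₁ : ∀ {u v M} → Turn D (u ∷ v ∷ M) → Separated₁ (adj G a u) (adj G b u) (adj G a v) (adj G b v)
    gap₁ t = max-insert₁ m′ (∉-turn a∉ t) , max-insert₁ m′ (∉-turn b∉ t)
      , (λ e f → max-insert m′ w uP (λ i → ∉-turn (disj i) t) (~-sym e) f)
      , (λ e f → max-insert m′ r-walk r-unique (λ i → ∉-turn (r-disj i) t) (~-sym e) f)
      where m′ = max-turn m t

    -- Replacing `M` by P, in either direction, would give a cycle of length |D| - |M| + |P|, which
    -- exceeds c.
    gap : ∀ {u v} M B → Turn D (u ∷ M ++ v ∷ B) → c + length M < length D + length P →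
      Separated₂ (adj G a u) (adj G b u) (adj G a v) (adj G b v)
    gap {u} {v} M B t lt =
        (λ e f → absurd P refl (bypass M B (cycle t) w uP (λ i → ∉-turn (disj i) t) (~-sym e) f))
      , (λ e f → absurd rP (↭-length (↭-reverse P))
                   (bypass M B (cycle t) r-walk r-unique (λ i → ∉-turn (r-disj i) t) (~-sym e) f))
      where
      absurd : ∀ Q → length Q ≡ length P → ¬ IsCycle G (u ∷ Q ++ v ∷ B)
      absurd Q eq cyc = <⇒≱ lt (begin
        length D + length P                       ≡⟨ cong₂ _+_ (sym (len t)) (sym eq) ⟩
        suc (length (M ++ v ∷ B)) + length Q      ≡⟨ cong (λ z → suc z + length Q) (L.length-++ M) ⟩
        suc (length M + length (v ∷ B)) + length Q ≡⟨ lem (length M) (length (v ∷ B)) (length Q) ⟩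
        suc (length Q + length (v ∷ B)) + length M ≡⟨ cong (λ z → suc z + length M) (sym (L.length-++ Q)) ⟩
        length (u ∷ Q ++ v ∷ B) + length M        ≤⟨ +-monoˡ-≤ (length M) (c-bound _ cyc) ⟩
        c + length M                              ∎)
        where
        open ≤-Reasoning
        lem : ∀ x y z → suc (x + y) + z ≡ suc (z + y) + x
        lem = solve-∀

    score : Fin n → ℕ
    score v = bit (adj G a v) + bit (adj G b v)

    sum-score : sum (map score D) ≡ onDeg a D + onDeg b D
    sum-score = trans (sum-map-+ _ _ D) (cong₂ _+_ (sum-adj a (proj₁ m)) (sum-adj b (proj₁ m)))

    -- Maximality separates consecutive vertices, and a detour from the first to the third vertex of
    -- a window skips only one vertex, so it would be too long.
    ends-≤₃ : c + 1 < length D + length P → 3 * (onDeg a D + onDeg b D) ≤ length D * 2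
    ends-≤₃ lt = subst (λ z → 3 * z ≤ length D * 2) sum-score
      (window-bound (Turn D) turn-rot 3 score 2 step (turn-refl (proj₁ m)))
      where
      step : ∀ {L} → Turn D L → window 3 score L ≤ 2
      step {[]} t = case cycle t of λ ()
      step {u ∷ []} t = case cycle-length (cycle t) of λ { (s≤s ()) }
      step {u ∷ v ∷ []} t = case cycle-length (cycle t) of λ { (s≤s (s≤s ())) }
      step {u ∷ v ∷ x ∷ M} t = window₃≤2 (adj G a u) (adj G b u) (adj G a v) (adj G b v) (adj G a x) (adj G b x)
        (gap₁ t) (gap₁ (turn-rot t)) (gap (v ∷ []) M t lt)

    -- Now even a detour that skips two vertices would be too long, so a window of four carries no
    -- more score than one of three.
    ends-≤₄ : 4 ≤ length D → c + 2 < length D + length P → 4 * (onDeg a D + onDeg b D) ≤ length D * 2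
    ends-≤₄ four lt = subst (λ z → 4 * z ≤ length D * 2) sum-score
      (window-bound (Turn D) turn-rot 4 score 2 step (turn-refl (proj₁ m)))
      where
      lt′ : c + 1 < length D + length P
      lt′ = ≤-<-trans (+-monoʳ-≤ c (s≤s z≤n)) lt
      step : ∀ {L} → Turn D L → window 4 score L ≤ 2
      step {L} t with subst (4 ≤_) (sym (len t)) four
      step {u ∷ v ∷ x ∷ y ∷ M} t | _ = window₄≤2
        (adj G a u) (adj G b u) (adj G a v) (adj G b v) (adj G a x) (adj G b x) (adj G a y) (adj G b y)
        (gap₁ t) (gap₁ (turn-rot t)) (gap₁ (turn-rot (turn-rot t)))
        (gap (v ∷ []) (y ∷ M) t lt′) (gap (x ∷ []) (M ++ u ∷ []) (turn-rot t) lt′) (gap (v ∷ x ∷ []) M t lt)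
      step {u ∷ v ∷ x ∷ []} t | s≤s (s≤s (s≤s ()))
      step {u ∷ v ∷ []} t | s≤s (s≤s ())
      step {u ∷ []} t | s≤s ()

-- Small complements of cycles

-- Closes linear arithmetic: hypotheses are added with suitable multipliers to give a ≤ b, and the
-- ring solver confirms that a exceeds b by e + 1.
≤-absurd : ∀ {a b} e → a ≤ b → a ≡ suc (b + e) → ⊥
≤-absurd {a} {b} e h eq = <⇒≱ (subst (b <_) (sym eq) (s≤s (m≤m+n b e))) h

module Outside {n : ℕ} (G : Graph n) where
  open Cycles G
  open Turn
  open Windows G

  #-∁mem : ∀ {D} → IsCycle G D → length D + # (∁ᵇ (mem D)) ≡ n
  #-∁mem {D} c = trans (cong (_+ # (∁ᵇ (mem D))) (sym (#-mem (cycle-unique c)))) (#-∁ (mem D))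

  ∈∁mem⁺ : ∀ {D} {v : Fin n} → v ∉ D → v ∈ᵇ ∁ᵇ (mem D)
  ∈∁mem⁺ {D} h = ¬T⇒T-not (h ∘ mem⁻ {L = D})

  ∈∁mem⁻ : ∀ {D} {v : Fin n} → v ∈ᵇ ∁ᵇ (mem D) → v ∉ D
  ∈∁mem⁻ {D} h i = T-not⇒¬T h (mem⁺ {L = D} i)

  offNbrs : Fin n → List (Fin n) → BSet n
  offNbrs x D = adj G x ∩ᵇ ∁ᵇ (mem D)

  ∈offNbrs⁻ : ∀ {D x v} → v ∈ᵇ offNbrs x D → x ~ v × v ∉ D
  ∈offNbrs⁻ {D} {x} {v} i = let e , h = ∈∩⁻ {adj G x v} i in e , ∈∁mem⁻ h

  offDeg< : ∀ {D x} → x ∉ D → suc (offDeg x D) ≤ # (∁ᵇ (mem D))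
  offDeg< {D} {x} x∉ = subst (λ z → z + offDeg x D ≤ # (∁ᵇ (mem D))) (#-⁅⁆ x)
    (#-disjoint {p = ⁅ x ⁆} {q = offNbrs x D}
      (λ v i → subst (_∈ᵇ ∁ᵇ (mem D)) (sym (∈⁅⁆⁻ i)) (∈∁mem⁺ x∉))
      (λ v i → proj₂ (∈∩⁻ {adj G x v} i))
      (λ v i j → ~⇒≢ (proj₁ (∈offNbrs⁻ {D} j)) (sym (∈⁅⁆⁻ i))))

  #-pair≤ : ∀ {u v} {p : BSet n} → (∀ w → w ∈ᵇ p → w ≡ u ⊎ w ≡ v) → # p ≤ 2
  #-pair≤ {u} {v} {p} h = subst (# p ≤_) (cong₂ _+_ (#-⁅⁆ u) (#-⁅⁆ v))
    (#-cover {p = ⁅ u ⁆} {q = ⁅ v ⁆} λ w i → [ (λ e → inj₁ (fromWitness e)) , (λ e → inj₂ (fromWitness e)) ]′ (h w i))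

  #-pair : ∀ {u v : Fin n} → u ≢ v → # (⁅ u ⁆ ∪ᵇ ⁅ v ⁆) ≡ 2
  #-pair {u} {v} ne = trans (#-insert {p = ⁅ u ⁆} λ i → ne (sym (∈⁅⁆⁻ i))) (cong suc (#-⁅⁆ u))

  -- The property shared by all unions of components of G - D.
  Closed : List (Fin n) → BSet n → Set
  Closed D K = ∀ z w → z ∈ᵇ K → w ∉ D → z ~ w → w ∈ᵇ K

  record Component (D : List (Fin n)) (x : Fin n) (K : BSet n) : Set where
    field
      root   : x ∈ᵇ K
      avoid  : ∀ {z} → z ∈ᵇ K → z ∉ D
      walks  : ∀ {z} → z ∈ᵇ K → ∃ λ L → Walk x z L × Unique L × (∀ {v} → v ∈ L → v ∈ᵇ K)

  -- A search from x: as long as an edge leads from K′ to a new vertex off D, that vertex is added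
  -- and the path to it recorded. The fuel `f` bounds the number of missing vertices. Since K is
  -- closed, the search never leaves it.
  component : ∀ {D x K} → x ∉ D → x ∈ᵇ K → Closed D K →
    ∃ λ K′ → Component D x K′ × Closed D K′ × K′ ⊆ᵇ K
  component {D} {x} {K} x∉ xK cl = grow n ⁅ x ⁆ start (λ v i → subst (_∈ᵇ K) (sym (∈⁅⁆⁻ i)) xK) (m≤n+m n _)
    where
    start : Component D x ⁅ x ⁆
    start = record
      { root  = ∈⁅⁆ x
      ; avoid = λ i → subst (_∉ D) (sym (∈⁅⁆⁻ i)) x∉
      ; walks = λ i → x ∷ [] , subst (λ z → Walk x z (x ∷ [])) (sym (∈⁅⁆⁻ i)) (single x) , [] ∷ []
                    , λ { (here refl) → ∈⁅⁆ x } }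
    grow : ∀ f K′ → Component D x K′ → K′ ⊆ᵇ K → n ≤ # K′ + f →
      ∃ λ K′ → Component D x K′ × Closed D K′ × K′ ⊆ᵇ K
    grow f K′ C s le
      with any? (λ z → any? (λ w → T? (K′ z) ×-dec T? (not (mem D w)) ×-dec T? (not (K′ w)) ×-dec T? (adj G z w)))
    ... | no ¬r = K′ , C , closed , s
      where
      closed : Closed D K′
      closed z w i h e = decidable-stable (T? (K′ w)) λ j → ¬r (z , w , i , ∈∁mem⁺ h , ¬T⇒T-not j , e)
    grow zero K′ C s le | yes (z , w , i , h , j , e) = ⊥-elim (<⇒≱ lt (#≤n (K′ ∪ᵇ ⁅ w ⁆)))
      where
      lt : n < # (K′ ∪ᵇ ⁅ w ⁆)
      lt = subst (n <_) (sym (#-insert {p = K′} (T-not⇒¬T j))) (s≤s (subst (n ≤_) (+-identityʳ _) le))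
    grow (suc f) K′ C s le | yes (z , w , i , h , j , e) = grow f (K′ ∪ᵇ ⁅ w ⁆) C′
      (λ v a → [ s v , (λ b → subst (_∈ᵇ K) (sym (∈⁅⁆⁻ b)) (cl z w (s z i) (∈∁mem⁻ h) e)) ]′ (∈∪⁻ a))
      (subst (n ≤_) (trans (+-suc (# K′) f) (cong (_+ f) (sym (#-insert {p = K′} (T-not⇒¬T j))))) le)
      where
      open Component C
      C′ : Component D x (K′ ∪ᵇ ⁅ w ⁆)
      C′ = record
        { root  = ∈∪ˡ root
        ; avoid = λ a → [ avoid , (λ b → subst (_∉ D) (sym (∈⁅⁆⁻ b)) (∈∁mem⁻ h)) ]′ (∈∪⁻ a)
        ; walks = λ a → [ (λ b → let L , W , u , m = walks b in L , W , u , λ {v} v∈ → ∈∪ˡ {K′ v} (m v∈))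
                        , (λ b → subst (λ y → ∃ λ L → Walk x y L × Unique L × (∀ {v} → v ∈ L → v ∈ᵇ (K′ ∪ᵇ ⁅ w ⁆)))
                                   (sym (∈⁅⁆⁻ b)) new) ]′ (∈∪⁻ a) }
        where
        new : ∃ λ L → Walk x w L × Unique L × (∀ {v} → v ∈ L → v ∈ᵇ (K′ ∪ᵇ ⁅ w ⁆))
        new with walks i
        ... | L , W , u , m = L ++ w ∷ [] , walk-++ W e (single w)
          , unique-++⁺ u ([] ∷ []) (λ { a (here refl) → T-not⇒¬T j (m a) })
          , λ a → [ (λ b → ∈∪ˡ (m b)) , (λ { (here refl) → ∈∪ʳ {K′ w} (∈⁅⁆ w) }) ]′ (∈-++⁻ L a)

-- Part (ii): degrees, and short paths off cycles of length k or k + 1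

module NearSpanning {n : ℕ} (G : Graph n) (k q : ℕ) (k+q≡n : k + q ≡ n) (3≤k : 3 ≤ k) (k+4≤3q : k + 4 ≤ 3 * q)
               (cyclable : KCyclable k G) (c-bound : ∀ C → IsCycle G C → length C ≤ suc k) where
  open Cycles G
  open Turn
  open Windows G
  open Outside G

  #-∁ᵇ-q : ∀ {X} → # X ≡ q → # (∁ᵇ X) ≡ k
  #-∁ᵇ-q {X} e = +-cancelʳ-≡ q _ _
      (trans (+-comm _ q) (trans (cong (_+ # (∁ᵇ X)) (sym e)) (trans (#-∁ X) (sym k+q≡n))))

  Covers : List (Fin n) → BSet n → Set
  Covers D X = ∀ {v} → v ∉ D → v ∈ᵇ X

  coverCycle : ∀ {X} → # X ≡ q → ∃ λ D → IsCycle G D × Covers D X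
  coverCycle {X} e with cyclable (toSubset (∁ᵇ X)) (trans (∣toSubset∣ (∁ᵇ X)) (#-∁ᵇ-q e))
  ... | D , c , h = D , c , λ {v} v∉ → decidable-stable (T? (X v)) λ i → v∉ (h v (∈-toSubset⁺ {p = ∁ᵇ X} (¬T⇒T-not i)))

  ∁⊆ : ∀ {D X v} → Covers D X → v ∈ᵇ ∁ᵇ X → v ∈ D
  ∁⊆ {D} {X} {v} h i = [ id , (λ v∉ → ⊥-elim (T-not⇒¬T i (h v∉))) ]′ (∈-dec v D)

  cover-length : ∀ {D X} → # X ≡ q → IsCycle G D → Covers D X → k ≤ length D
  cover-length {D} {X} e c h = subst₂ _≤_ (#-∁ᵇ-q e) (#-mem (cycle-unique c))
    (#-mono {p = ∁ᵇ X} λ v i → mem⁺ (∁⊆ h i))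

  -- Phrased as a refutation, so that maximality need not be decided: a covering cycle has at least
  -- k vertices, so any cycle enlarging it has k + 1 and admits no longer one.
  maxCycle : ∀ {X} → # X ≡ q → (∀ D → Max D → k ≤ length D → Covers D X → ⊥) → ⊥
  maxCycle {X} e f with coverCycle {X} e
  ... | D , c , h = f D (c , λ C cC lt sub →
          f C (cC , λ C′ cC′ lt′ _ → <⇒≱ (≤-<-trans (≤-trans (s≤s k≤) lt) lt′) (c-bound C′ cC′))
            (≤-trans k≤ (<⇒≤ lt)) (λ v∉ → h (v∉ ∘ sub))) k≤ h
    where
    k≤ = cover-length e c h

  -- D contains the k vertices outside X; together with a and b these would be k + 2.
  cover-misses : ∀ {D X a b} → # X ≡ q → IsCycle G D → Covers D X → a ≢ b →
    a ∈ᵇ X → b ∈ᵇ X → a ∈ D → b ∈ D → ⊥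
  cover-misses {D} {X} {a} {b} e c h ne aX bX aD bD = ≤-absurd 0
    (≤-trans (#-disjoint {p = ∁ᵇ X} {q = ⁅ a ⁆ ∪ᵇ ⁅ b ⁆} {r = mem D} (λ v i → mem⁺ (∁⊆ h i))
      (λ v i → mem⁺ ([ (λ j → subst (_∈ D) (sym (∈⁅⁆⁻ j)) aD) , (λ j → subst (_∈ D) (sym (∈⁅⁆⁻ j)) bD) ]′
          (∈∪⁻ {⁅ a ⁆ v} i)))
      (λ v i j → T-not⇒¬T i ([ (λ j → subst (_∈ᵇ X) (sym (∈⁅⁆⁻ j)) aX) ,
          (λ j → subst (_∈ᵇ X) (sym (∈⁅⁆⁻ j)) bX) ]′ (∈∪⁻ {⁅ a ⁆ v} j))))
      (subst (_≤ suc k) (sym (#-mem (cycle-unique c))) (c-bound D c)))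
    (trans (cong₂ _+_ (#-∁ᵇ-q e) (#-pair ne)) (lem k))
    where
    lem : ∀ k → k + 2 ≡ suc (suc k + 0)
    lem = solve-∀

  tight-misses : ∀ {D X a} → # X ≡ q → IsCycle G D → Covers D X → length D ≡ k → a ∈ᵇ X → a ∉ D
  tight-misses {D} {X} {a} e c h l aX aD = ≤-absurd 0
    (#-disjoint {p = ∁ᵇ X} {q = ⁅ a ⁆} {r = mem D} (λ v i → mem⁺ (∁⊆ h i))
      (λ v i → mem⁺ (subst (_∈ D) (sym (∈⁅⁆⁻ i)) aD))
      (λ v i j → T-not⇒¬T i (subst (_∈ᵇ X) (sym (∈⁅⁆⁻ j)) aX)))
    (trans (cong₂ _+_ (#-∁ᵇ-q e) (#-⁅⁆ a))
        (trans (lem k) (cong (λ z → suc (z + 0)) (sym (trans (#-mem (cycle-unique c)) l)))))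
    where
    lem : ∀ k → k + 1 ≡ suc (k + 0)
    lem = solve-∀

  3≤q : 3 ≤ q
  3≤q with 3 ≤? q
  ... | yes h = h
  ... | no h  = ⊥-elim (≤-absurd 0 (≤-trans (+-monoˡ-≤ 4 3≤k) (≤-trans k+4≤3q (*-monoʳ-≤ 3 (≤-pred (≰⇒> h))))) refl)

  -- Delete all of N(v): the cycle through v and the remaining vertices would need two deleted neighbours of v.
  minDegree : ∀ v → suc q ≤ # (adj G v)
  minDegree v with suc q ≤? # (adj G v)
  ... | yes h = h
  ... | no h with #-choose (adj G v) (∁ᵇ ⁅ v ⁆) q
                    (λ w e → ¬T⇒T-not λ i → ~⇒≢ e (sym (∈⁅⁆⁻ i))) (≤-pred (≰⇒> h)) q≤
    where
    q≤ : q ≤ # (∁ᵇ ⁅ v ⁆)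
    q≤ = +-cancelˡ-≤ 1 _ _ (subst₂ _≤_ refl (trans k+q≡n (trans (sym (#-∁ ⁅ v ⁆)) (cong (_+ # (∁ᵇ ⁅ v ⁆)) (#-⁅⁆ v))))
           (+-monoˡ-≤ q (≤-trans (s≤s z≤n) 3≤k)))
  ... | X , nX , Xv , eX with coverCycle eX
  ... | D , c , cov with turn-to c (∁⊆ cov (¬T⇒T-not λ i → T-not⇒¬T (Xv v i) (∈⁅⁆ v)))
  ... | [] , t with cycle-length (cycle t)
  ... | s≤s ()
  minDegree v | no h | X , nX , Xv , eX | D , c , cov | a ∷ [] , t with cycle-length (cycle t)
  ... | s≤s (s≤s ())
  minDegree v | no h | X , nX , Xv , eX | D , c , cov | a ∷ b ∷ M , t with cycle⇒walk (cycle t) | ∷≡++ b M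
  -- The neighbours of v along the cycle are the second entry and the last entry y. Both are deleted
  -- vertices, and they differ.
  ... | z , _∷ʷ_ {b = a′} e w , e′ | L , y , eq with walk-head w | walk-last (a ∷ L) (subst (λ s → Walk a′ z (a ∷ s)) eq w)
  ... | refl | refl = ⊥-elim (cover-misses eX c cov
      (λ a≡y → unique-∉ (unique-tail (cycle-unique (cycle t))) (subst (_∈ b ∷ M) (sym a≡y) y∈))
      (nX a e) (nX y (~-sym e′)) (sub t (there (here refl))) (sub t (there (there y∈))))
    where
    y∈ : y ∈ b ∷ M
    y∈ = subst (y ∈_) (sym eq) (∈-++⁺ʳ L (here refl))

  deg≥ : ∀ x D → suc q ≤ onDeg x D + offDeg x D
  deg≥ x D = subst (suc q ≤_) (deg-split x D) (minDegree x)

  length-cases : ∀ {D} → IsCycle G D → k ≤ length D → length D ≡ k ⊎ length D ≡ suc k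
  length-cases {D} c h with m≤n⇒m<n∨m≡n h
  ... | inj₁ lt = inj₂ (≤-antisym (c-bound D c) lt)
  ... | inj₂ e  = inj₁ (sym e)

  ends-sum : ∀ {D a b} s → offDeg a D + offDeg b D ≤ s → 2 * q + 2 ≤ onDeg a D + onDeg b D + s
  ends-sum {D} {a} {b} s h = begin
    2 * q + 2                                                   ≡⟨ lem q ⟩
    suc q + suc q                                               ≤⟨ +-mono-≤ (deg≥ a D) (deg≥ b D) ⟩
    onDeg a D + offDeg a D + (onDeg b D + offDeg b D)           ≡⟨ lem′ (onDeg a D) _ _ _ ⟩
    onDeg a D + onDeg b D + (offDeg a D + offDeg b D)           ≤⟨ +-monoʳ-≤ (onDeg a D + onDeg b D) h ⟩
    onDeg a D + onDeg b D + s                                   ∎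
    where
    open ≤-Reasoning
    lem : ∀ q → 2 * q + 2 ≡ suc q + suc q
    lem = solve-∀
    lem′ : ∀ a b c d → a + b + (c + d) ≡ a + c + (b + d)
    lem′ = solve-∀

  -- The edge is an ear with two vertices. The minimum degree leaves its ends at least 2q - 1
  -- neighbours on D in total, so windows of three give 6q - 3 ≤ 2k + 2, against 3q ≥ k + 4.
  no-edge : ∀ {D a b} → Max D → length D ≡ suc k → a ~ b → a ∉ D → b ∉ D → offDeg a D + offDeg b D ≤ 3 → ⊥
  no-edge {D} {a} {b} m l e a∉ b∉ s = ≤-absurd 2
    (+-mono-≤ (*-monoʳ-≤ 3 (ends-sum {D} {a} {b} 3 s)) (+-mono-≤ (*-monoʳ-≤ 2 k+4≤3q) ends))
    (lem q k (onDeg a D + onDeg b D))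
    where
    P-disj : ∀ {z} → z ∈ a ∷ b ∷ [] → z ∉ D
    P-disj (here refl)         = a∉
    P-disj (there (here refl)) = b∉
    open Ear m (e ∷ʷ single b) ((~⇒≢ e ∷ []) ∷ [] ∷ []) P-disj c-bound
    ends : 3 * (onDeg a D + onDeg b D) ≤ suc k * 2
    ends = subst (λ z → 3 * (onDeg a D + onDeg b D) ≤ z * 2) l
      (ends-≤₃ (subst (λ z → suc k + 1 < z + 2) (sym l) (s≤s (≤-reflexive (sym (+-suc k 1))))))
    lem : ∀ q k s → 3 * (2 * q + 2) + (2 * (k + 4) + 3 * s) ≡ suc (3 * (s + 3) + (2 * (3 * q) + suc k * 2) + 2)
    lem = solve-∀

  ∉-triple : ∀ {D} {a w b : Fin n} → a ∉ D → w ∉ D → b ∉ D → ∀ {z} → z ∈ a ∷ w ∷ b ∷ [] → z ∉ D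
  ∉-triple a∉ w∉ b∉ (here refl)                 = a∉
  ∉-triple a∉ w∉ b∉ (there (here refl))         = w∉
  ∉-triple a∉ w∉ b∉ (there (there (here refl))) = b∉

  -- The ends of the path a w b have at least 2q - 2 neighbours on D in total. If |D| = k, windows
  -- of three give 6q - 6 ≤ 2k; if |D| = k + 1, windows of four give 8q - 8 ≤ 2k + 2. Both
  -- contradict 3q ≥ k + 4, the second with the help of q ≥ 3.
  no-cherry : ∀ {D a w b} → Max D → k ≤ length D → a ≢ b → a ~ w → w ~ b → a ∉ D → w ∉ D → b ∉ D →
    offDeg a D + offDeg b D ≤ 4 → ⊥
  no-cherry {D} {a} {w} {b} m k≤ ne e₁ e₂ a∉ w∉ b∉ s with length-cases (proj₁ m) k≤
  ... | inj₁ l = ≤-absurd 1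
    (+-mono-≤ (*-monoʳ-≤ 3 (ends-sum {D} {a} {b} 4 s)) (+-mono-≤ (*-monoʳ-≤ 2 k+4≤3q) ends))
    (lem q k (onDeg a D + onDeg b D))
    where
    open Ear m (e₁ ∷ʷ e₂ ∷ʷ single b) ((~⇒≢ e₁ ∷ ne ∷ []) ∷ (~⇒≢ e₂ ∷ []) ∷ [] ∷ []) (∉-triple a∉ w∉ b∉) c-bound
    ends : 3 * (onDeg a D + onDeg b D) ≤ k * 2
    ends = subst (λ z → 3 * (onDeg a D + onDeg b D) ≤ z * 2) l
      (ends-≤₃ (subst (λ z → suc k + 1 < z + 3) (sym l) (≤-reflexive (lem₀ k))))
      where
      lem₀ : ∀ k → suc (suc k + 1) ≡ k + 3
      lem₀ = solve-∀
    lem : ∀ q k s → 3 * (2 * q + 2) + (2 * (k + 4) + 3 * s) ≡ suc (3 * (s + 4) + (2 * (3 * q) + k * 2) + 1)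
    lem = solve-∀
  ... | inj₂ l = ≤-absurd 3
    (+-mono-≤ (*-monoʳ-≤ 4 (ends-sum {D} {a} {b} 4 s))
        (+-mono-≤ (*-monoʳ-≤ 2 k+4≤3q) (+-mono-≤ ends (*-monoʳ-≤ 2 3≤q))))
    (lem q k (onDeg a D + onDeg b D))
    where
    open Ear m (e₁ ∷ʷ e₂ ∷ʷ single b) ((~⇒≢ e₁ ∷ ne ∷ []) ∷ (~⇒≢ e₂ ∷ []) ∷ [] ∷ []) (∉-triple a∉ w∉ b∉) c-bound
    ends : 4 * (onDeg a D + onDeg b D) ≤ suc k * 2
    ends = subst (λ z → 4 * (onDeg a D + onDeg b D) ≤ z * 2) l
      (ends-≤₄ (subst (4 ≤_) (sym l) (s≤s 3≤k)) (subst (λ z → suc k + 2 < z + 3) (sym l) (≤-reflexive (lem₀ k))))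
      where
      lem₀ : ∀ k → suc (suc k + 2) ≡ suc k + 3
      lem₀ = solve-∀
    lem : ∀ q k s → 4 * (2 * q + 2) + (2 * (k + 4) + (4 * s + 6)) ≡ suc (4 * (s + 4) + (2 * (3 * q) + (suc k * 2 + 2 * q)) + 3)
    lem = solve-∀

  #-outside≤ : ∀ {D} → IsCycle G D → k ≤ length D → # (∁ᵇ (mem D)) ≤ q
  #-outside≤ {D} c h = +-cancelˡ-≤ k _ _
      (subst (k + # (∁ᵇ (mem D)) ≤_) (trans (#-∁mem c) (sym k+q≡n)) (+-monoˡ-≤ _ h))

  #-outside≥ : ∀ {D} → IsCycle G D → q ≤ suc (# (∁ᵇ (mem D)))
  #-outside≥ {D} c = +-cancelˡ-≤ k _ _
      (subst₂ _≤_ (trans (#-∁mem c) (sym k+q≡n)) (sym (+-suc k _)) (+-monoˡ-≤ (# (∁ᵇ (mem D))) (c-bound D c)))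

  -- The degree is at least q + 1, while at most q - 1 vertices other than x lie off D.
  onDeg≥2 : ∀ {D x} → IsCycle G D → k ≤ length D → x ∉ D → 2 ≤ onDeg x D
  onDeg≥2 {D} {x} c h x∉ = +-cancelʳ-≤ (offDeg x D) 2 (onDeg x D)
    (≤-trans (s≤s (≤-trans (offDeg< x∉) (#-outside≤ c h))) (deg≥ x D))

-- Part (ii): the contradiction

module NearSpanningAbsurd {n : ℕ} (G : Graph n) (k q : ℕ) (k+q≡n : k + q ≡ n) (3≤k : 3 ≤ k) (k+4≤3q : k + 4 ≤ 3 * q)
               (cyclable : KCyclable k G) (c-bound : ∀ C → IsCycle G C → length C ≤ suc k) where
  open Cycles G
  open Turn
  open Windows G
  open Outside G
  open NearSpanning G k q k+q≡n 3≤k k+4≤3q cyclable c-bound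

  module OffCover {D : List (Fin n)} {X I : BSet n} (m : Max D) (k≤ : k ≤ length D) (cov : Covers D X) (ind : Independent I) where

    -- Every neighbour of y off D lies in X but not in I, which leaves only w and w′.
    offDeg-independent : ∀ {w w′ y} → (∀ v → v ∈ᵇ X → v ∈ᵇ I ⊎ v ≡ w ⊎ v ≡ w′) → y ∈ᵇ I → offDeg y D ≤ 2
    offDeg-independent {w} {w′} {y} split yI = #-pair≤ {u = w} {v = w′} λ v i →
      let e , h = ∈offNbrs⁻ {D} i in
      [ (λ vI → ⊥-elim (ind y v yI vI e)) , id ]′ (split v (cov h))

    -- A second neighbour of w in I off D gives a cherry centred at w. Otherwise either the degrees
    -- off D add up to at most three and `no-edge` applies, or w and y are both adjacent to w′,
    -- which is then the centre of a cherry.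
    no-star : ∀ {w w′ y} → length D ≡ suc k → (∀ v → v ∈ᵇ X → v ∈ᵇ I ⊎ v ≡ w ⊎ v ≡ w′) →
      y ∈ᵇ I → y ∉ D → w ∉ D → w ~ y → ⊥
    no-star {w} {w′} {y} l split yI y∉ w∉ e
      with any? (λ v → T? (offNbrs w D v) ×-dec T? (I v) ×-dec ¬? (v ≟ y))
    ... | yes (v , i , vI , ne) = let e′ , v∉ = ∈offNbrs⁻ {D} i in
      no-cherry m k≤ (ne ∘ sym) (~-sym e) e′ y∉ w∉ v∉
        (+-mono-≤ (offDeg-independent split yI) (offDeg-independent split vI))
    ... | no ¬v = case offDeg w D + offDeg y D ≤? 3 of λ
        { (yes s) → no-edge m l e w∉ y∉ s
        ; (no s)  → triangle (≰⇒> s) }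
      where
      y≤2 : offDeg y D ≤ 2
      y≤2 = offDeg-independent split yI
      onlyW : ∀ v → v ∈ᵇ offNbrs w D → v ≡ y ⊎ v ≡ w′
      onlyW v i with v ≟ y
      ... | yes p = inj₁ p
      ... | no ne with split v (cov (proj₂ (∈offNbrs⁻ {D} i)))
      ... | inj₁ vI        = ⊥-elim (¬v (v , i , vI , ne))
      ... | inj₂ (inj₁ p)  = ⊥-elim (~⇒≢ (proj₁ (∈offNbrs⁻ {D} i)) (sym p))
      ... | inj₂ (inj₂ p)  = inj₂ p
      w≤2 : offDeg w D ≤ 2
      w≤2 = #-pair≤ onlyW
      triangle : 4 ≤ offDeg w D + offDeg y D → ⊥
      triangle s with #-another {p = offNbrs w D} y (+-cancelʳ-≤ 2 2 _ (≤-trans s (+-monoʳ-≤ (offDeg w D) y≤2)))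
                    | #-another {p = offNbrs y D} w (+-cancelˡ-≤ 2 2 _ (≤-trans s (+-monoˡ-≤ (offDeg y D) w≤2)))
      ... | a , ai , a≢y | b , bi , b≢w with onlyW a ai | split b (cov (proj₂ (∈offNbrs⁻ {D} bi)))
      ... | inj₁ p    | _              = a≢y p
      ... | _         | inj₁ bI        = ind y b yI bI (proj₁ (∈offNbrs⁻ {D} bi))
      ... | _         | inj₂ (inj₁ p)  = b≢w p
      ... | inj₂ refl | inj₂ (inj₂ refl) =
        no-cherry m k≤ (~⇒≢ e) (proj₁ (∈offNbrs⁻ {D} ai)) (~-sym (proj₁ (∈offNbrs⁻ {D} bi)))
          w∉ (proj₂ (∈offNbrs⁻ {D} ai)) y∉ (+-mono-≤ w≤2 y≤2)

  ∈-or : ∀ {D : List (Fin n)} a b → (a ∈ D → b ∈ D → ⊥) → a ∉ D ⊎ b ∉ D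
  ∈-or {D} a b h with ∈-dec a D
  ... | inj₁ i = inj₂ (h i)
  ... | inj₂ i = inj₁ i

  -- If x has few neighbours off D, then x and its successors form a large independent set I; a cycle
  -- avoiding all but two vertices of a subset of I ∪ {d₁, d₂} is then contradictory.
  few-off-absurd : ∀ {D x} → 4 ≤ q → Max D → k ≤ length D → x ∉ D → offDeg x D ≤ 4 → ⊥
  few-off-absurd {D} {x} 4≤q m k≤ x∉ off≤4
    with #-nonempty {p = succs x D} (≤-trans (≤-trans (s≤s z≤n) (onDeg≥2 (proj₁ m) k≤ x∉)) (≤-reflexive (sym (#-succs x (proj₁ m)))))
  ... | w₁ , w₁S with turn-pred (proj₁ m) (succs⊆ w₁S) | proj₁ (∈∩⁻ {adj G x (pred D w₁)} w₁S)
  ... | M , t | e₁ with #-another {p = adj G x ∩ᵇ mem D} (pred D w₁) (onDeg≥2 (proj₁ m) k≤ x∉)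
  ... | d₂ , d₂i , d₂≢d₁ =
    let X , P⊆X , X⊆Q , #X = #-choose P Q q P⊆Q (≤-trans #P≤4 4≤q) q≤#Q in
    maxCycle #X (finish P⊆X X⊆Q #X)
    where
    d₁ = pred D w₁
    e₂ : x ~ d₂
    e₂ = proj₁ (∈∩⁻ {adj G x d₂} d₂i)
    I = starSet x D
    Q = (I ∪ᵇ ⁅ d₁ ⁆) ∪ᵇ ⁅ d₂ ⁆
    -- Forced into X: the path x d₁ w₁ and a second neighbour d₂ of x.
    P = mem (x ∷ w₁ ∷ d₁ ∷ d₂ ∷ [])
    P⊆Q : P ⊆ᵇ Q
    P⊆Q v i with mem⁻ {L = x ∷ w₁ ∷ d₁ ∷ d₂ ∷ []} i
    ... | here refl = ∈∪ˡ (∈∪ˡ (∈∪ˡ (∈⁅⁆ v)))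
    ... | there (here refl) = ∈∪ˡ (∈∪ˡ (∈∪ʳ {⁅ x ⁆ v} w₁S))
    ... | there (there (here refl)) = ∈∪ˡ (∈∪ʳ {I v} (∈⁅⁆ v))
    ... | there (there (there (here refl))) = ∈∪ʳ {I v ∨ ⁅ d₁ ⁆ v} (∈⁅⁆ v)
    #P≤4 : # P ≤ 4
    #P≤4 = ≤-trans (#-cover {p = ⁅ x ⁆ ∪ᵇ ⁅ w₁ ⁆} {q = ⁅ d₁ ⁆ ∪ᵇ ⁅ d₂ ⁆} four) (+-mono-≤ (two x w₁) (two d₁ d₂))
      where
      two : ∀ a b → # (⁅ a ⁆ ∪ᵇ ⁅ b ⁆) ≤ 2
      two a b = #-pair≤ {u = a} {v = b} λ w i → [ (λ j → inj₁ (∈⁅⁆⁻ j)) , (λ j → inj₂ (∈⁅⁆⁻ j)) ]′ (∈∪⁻ {⁅ a ⁆ w} i)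
      four : ∀ v → v ∈ᵇ P → v ∈ᵇ (⁅ x ⁆ ∪ᵇ ⁅ w₁ ⁆) ⊎ v ∈ᵇ (⁅ d₁ ⁆ ∪ᵇ ⁅ d₂ ⁆)
      four v i with mem⁻ {L = x ∷ w₁ ∷ d₁ ∷ d₂ ∷ []} i
      ... | here refl = inj₁ (∈∪ˡ (∈⁅⁆ v))
      ... | there (here refl) = inj₁ (∈∪ʳ {⁅ x ⁆ v} (∈⁅⁆ v))
      ... | there (there (here refl)) = inj₂ (∈∪ˡ (∈⁅⁆ v))
      ... | there (there (there (here refl))) = inj₂ (∈∪ʳ {⁅ d₁ ⁆ v} (∈⁅⁆ v))
    nbr∉I : ∀ {d} → x ~ d → d ∉ᵇ I
    nbr∉I {d} e i = starSet-independent m x∉ x d (∈∪ˡ (∈⁅⁆ x)) i e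
    #Q : # Q ≡ 3 + onDeg x D
    #Q = trans (#-insert {p = I ∪ᵇ ⁅ d₁ ⁆} λ i → [ nbr∉I e₂ , (λ j → d₂≢d₁ (∈⁅⁆⁻ j)) ]′ (∈∪⁻ {I d₂} i))
      (cong suc (trans (#-insert {p = I} (nbr∉I e₁)) (cong suc (#-starSet (proj₁ m) x∉))))
    -- As the degree of x is at least q + 1, the bound `off≤4` leaves at least q - 3 successors; x,
    -- d₁ and d₂ make up the difference.
    q≤#Q : q ≤ # Q
    q≤#Q = +-cancelʳ-≤ 1 q (# Q) (begin
      q + 1                                ≡⟨ +-comm q 1 ⟩
      suc q                                ≤⟨ deg≥ x D ⟩
      onDeg x D + offDeg x D               ≤⟨ +-monoʳ-≤ (onDeg x D) off≤4 ⟩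
      onDeg x D + 4                        ≡⟨ lem (onDeg x D) ⟩
      3 + onDeg x D + 1                    ≡⟨ cong (_+ 1) #Q ⟨
      # Q + 1                              ∎)
      where
      open ≤-Reasoning
      lem : ∀ a → a + 4 ≡ 3 + a + 1
      lem = solve-∀
    module _ {X : BSet n} (P⊆X : P ⊆ᵇ X) (X⊆Q : X ⊆ᵇ Q) (#X : # X ≡ q) where
      in-X : ∀ {v} → v ∈ x ∷ w₁ ∷ d₁ ∷ d₂ ∷ [] → v ∈ᵇ X
      in-X i = P⊆X _ (mem⁺ i)
      x∈X  = in-X (here refl)
      w₁∈X = in-X (there (here refl))
      d₁∈X = in-X (there (there (here refl)))
      d₂∈X = in-X (there (there (there (here refl))))
      split : ∀ v → v ∈ᵇ X → v ∈ᵇ I ⊎ v ≡ d₁ ⊎ v ≡ d₂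
      split v i with ∈∪⁻ {I v ∨ ⁅ d₁ ⁆ v} (X⊆Q v i)
      ... | inj₂ j = inj₂ (inj₂ (∈⁅⁆⁻ j))
      ... | inj₁ j with ∈∪⁻ {I v} j
      ... | inj₁ vI = inj₁ vI
      ... | inj₂ l  = inj₂ (inj₁ (∈⁅⁆⁻ l))
      split′ : ∀ v → v ∈ᵇ X → v ∈ᵇ I ⊎ v ≡ d₂ ⊎ v ≡ d₁
      split′ v i = [ inj₁ , [ (λ p → inj₂ (inj₂ p)) , (λ p → inj₂ (inj₁ p)) ]′ ]′ (split v i)
      xI : x ∈ᵇ I
      xI = ∈∪ˡ (∈⁅⁆ x)
      w₁I : w₁ ∈ᵇ I
      w₁I = ∈∪ʳ {⁅ x ⁆ w₁} w₁S
      x≢w₁ : x ≢ w₁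
      x≢w₁ refl = x∉ (succs⊆ w₁S)
      d₁~w₁ : d₁ ~ w₁
      d₁~w₁ with cycle⇒walk (cycle t)
      ... | _ , e ∷ʷ w , _ = subst (d₁ ~_) (walk-head w) e
      finish : ∀ D′ → Max D′ → k ≤ length D′ → Covers D′ X → ⊥
      finish D′ m′ k≤′ cov = [ tight , loose ]′ (length-cases (proj₁ m′) k≤′)
        where
        open OffCover m′ k≤′ cov (starSet-independent m x∉)
        misses : ∀ {a b} → a ≢ b → a ∈ᵇ X → b ∈ᵇ X → a ∉ D′ ⊎ b ∉ D′
        misses ne aX bX = ∈-or _ _ (cover-misses #X (proj₁ m′) cov ne aX bX)
        cherry : x ∉ D′ → w₁ ∉ D′ → d₁ ∉ D′ → ⊥
        cherry h₁ h₂ h₃ = no-cherry m′ k≤′ x≢w₁ e₁ d₁~w₁ h₁ h₃ h₂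
          (+-mono-≤ (offDeg-independent split xI) (offDeg-independent split w₁I))
        -- A covering cycle with k vertices misses all of X, in particular the path x d₁ w₁.
        tight : length D′ ≡ k → ⊥
        tight l = cherry (out x∈X) (out w₁∈X) (out d₁∈X)
          where
          out : ∀ {a} → a ∈ᵇ X → a ∉ D′
          out = tight-misses #X (proj₁ m′) cov l
        -- At most one member of X lies on `D′`. If d₁ is off it, so is x or w₁, a leaf of a star at
        -- d₁; if d₁ is on it, both x and d₂ are off, and the star is at d₂.
        loose : length D′ ≡ suc k → ⊥
        loose l with ∈-dec d₁ D′
        ... | inj₂ d₁∉ = [ (λ h → no-star l split xI h d₁∉ (~-sym e₁)) , (λ h → no-star l split w₁I h d₁∉ d₁~w₁) ]′
                           (misses x≢w₁ x∈X w₁∈X)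
        ... | inj₁ d₁∈ = no-star l split′ xI
          ([ (λ h → ⊥-elim (h d₁∈)) , id ]′ (misses (~⇒≢ (~-sym e₁)) d₁∈X x∈X))
          ([ (λ h → ⊥-elim (h d₁∈)) , id ]′ (misses (d₂≢d₁ ∘ sym) d₁∈X d₂∈X))
          (~-sym (proj₁ (∈∩⁻ {adj G x d₂} d₂i)))

  -- Deleting a vertex h of the component of x and adding the successors of N(x) yields a cycle
  -- off which some component is strictly smaller.
  outside-absurd : 4 ≤ q → ∀ s {D x K} → Max D → k ≤ length D → x ∉ D → x ∈ᵇ K → Closed D K → # K ≤ s → ⊥
  outside-absurd 4≤q zero {D} {x} {K} m k≤ x∉ xK cl le =
    ≤-absurd 0 (≤-trans (subst (_≤ # K) (#-⁅⁆ x)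
        (#-mono {p = ⁅ x ⁆} λ v i → subst (_∈ᵇ K) (sym (∈⁅⁆⁻ i)) xK)) le) refl
  outside-absurd 4≤q (suc s) {D} {x} {K} m k≤ x∉ xK cl le with offDeg x D ≤? 4
  ... | yes off≤4 = few-off-absurd 4≤q m k≤ x∉ off≤4
  ... | no off≰4 with component x∉ xK cl | #-nonempty {p = offNbrs x D} (≤-trans (s≤s z≤n) (≰⇒> off≰4))
  ... | K′ , C , cl′ , K′⊆K | h , hi with #-another {p = offNbrs x D} h (≤-trans (s≤s (s≤s z≤n)) (≰⇒> off≰4))
  ... | y , yi , y≢h =
    let X , P⊆X , X⊆Q , #X = #-choose P Q q P⊆Q (≤-trans (≤-reflexive (#-pair (~⇒≢ (proj₁ (∈offNbrs⁻ {D} yi))))) (≤-trans (s≤s (s≤s z≤n)) 4≤q)) q≤#Q in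
    maxCycle #X λ D′ m′ k≤′ cov →
      -- At most one member of X lies on `D′`, so x or y is off it, and either serves as the new
      -- root in the smaller set `K₂`.
      [ (λ x∉′ → outside-absurd 4≤q s {K = K₂} m′ k≤′ x∉′ x∈K₂ (closed X⊆Q cov) #K₂≤s)
      , (λ y∉′ → outside-absurd 4≤q s {K = K₂} m′ k≤′ y∉′ y∈K₂ (closed X⊆Q cov) #K₂≤s) ]′
      (∈-or x y (cover-misses #X (proj₁ m′) cov (~⇒≢ x~y) (P⊆X x (∈∪ˡ (∈⁅⁆ x))) (P⊆X y (∈∪ʳ {⁅ x ⁆ y} (∈⁅⁆ y)))))
    where
    P = ⁅ x ⁆ ∪ᵇ ⁅ y ⁆
    R = ∁ᵇ (mem D) ∩ᵇ ∁ᵇ ⁅ h ⁆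
    Q = R ∪ᵇ succs x D
    P⊆Q : P ⊆ᵇ Q
    P⊆Q v i with ∈∪⁻ {⁅ x ⁆ v} i
    ... | inj₁ j rewrite ∈⁅⁆⁻ {v = x} {w = v} j = ∈∪ˡ (∈∩⁺ (∈∁mem⁺ x∉) (¬T⇒T-not λ l → ~⇒≢ (proj₁ (∈offNbrs⁻ {D} hi)) (∈⁅⁆⁻ l)))
    ... | inj₂ j rewrite ∈⁅⁆⁻ {v = y} {w = v} j = ∈∪ˡ (∈∩⁺ (∈∁mem⁺ (proj₂ (∈offNbrs⁻ {D} yi))) (¬T⇒T-not λ l → y≢h (∈⁅⁆⁻ l)))
    outside≤ : # (∁ᵇ (mem D)) ≤ 1 + # R
    outside≤ = subst (λ z → # (∁ᵇ (mem D)) ≤ z + # R) (#-⁅⁆ h) (#-cover {p = ⁅ h ⁆} {q = R} λ v i →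
      [ inj₁ , (λ j → inj₂ (∈∩⁺ i j)) ]′ (T⊎T-not (⁅ h ⁆ v)))
    -- At least q - 1 vertices lie off D; giving up h costs one, and there are at least two
    -- successors.
    q≤#Q : q ≤ # Q
    q≤#Q = begin
      q                             ≤⟨ #-outside≥ (proj₁ m) ⟩
      suc (# (∁ᵇ (mem D)))          ≤⟨ s≤s outside≤ ⟩
      2 + # R                       ≤⟨ +-monoˡ-≤ (# R) (onDeg≥2 (proj₁ m) k≤ x∉) ⟩
      onDeg x D + # R               ≡⟨ +-comm (onDeg x D) (# R) ⟩
      # R + onDeg x D               ≡⟨ cong (# R +_) (#-succs x (proj₁ m)) ⟨
      # R + # (succs x D)           ≤⟨ #-disjoint {p = R} {q = succs x D} (λ v → ∈∪ˡ) (λ v → ∈∪ʳ {R v})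
                                        (λ v i j → ∈∁mem⁻ (proj₁ (∈∩⁻ {not (mem D v)} i)) (succs⊆ j)) ⟩
      # Q                           ∎
      where open ≤-Reasoning
    open Component C
    x~y = proj₁ (∈offNbrs⁻ {D} yi)
    x~h = proj₁ (∈offNbrs⁻ {D} hi)
    K₂ = K′ ∩ᵇ ∁ᵇ ⁅ h ⁆
    x∈K₂ : x ∈ᵇ K₂
    x∈K₂ = ∈∩⁺ root (¬T⇒T-not λ l → ~⇒≢ x~h (∈⁅⁆⁻ l))
    y∈K₂ : y ∈ᵇ K₂
    y∈K₂ = ∈∩⁺ (cl′ x y root (proj₂ (∈offNbrs⁻ {D} yi)) x~y) (¬T⇒T-not λ l → y≢h (∈⁅⁆⁻ l))
    #K₂≤s : # K₂ ≤ s
    #K₂≤s = ≤-pred (≤-trans (subst (λ z → z + # K₂ ≤ # K′) (#-⁅⁆ h) (#-disjoint {p = ⁅ h ⁆} {q = K₂}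
      (λ v i → subst (_∈ᵇ K′) (sym (∈⁅⁆⁻ i)) (cl′ x h root (proj₂ (∈offNbrs⁻ {D} hi)) x~h))
      (λ v i → proj₁ (∈∩⁻ {K′ v} i))
      (λ v i j → T-not⇒¬T (proj₂ (∈∩⁻ {K′ v} j)) i))) (≤-trans (#-mono K′⊆K) le))
    -- A vertex w off `D′` lies in Q. If it is a successor, the path from x to z inside K′ could be
    -- inserted between `pred D w` and w, against the maximality of D. Otherwise w is off D, differs
    -- from h, and is reached from z within K′.
    closed : ∀ {X D′} → X ⊆ᵇ Q → Covers D′ X → Closed D′ K₂
    closed X⊆Q cov z w zK w∉ e with ∈∪⁻ {not (mem D w) ∧ not (⁅ h ⁆ w)} (X⊆Q w (cov w∉))
    ... | inj₁ i = let a , b = ∈∩⁻ {not (mem D w)} i in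
      ∈∩⁺ (cl′ z w (proj₁ (∈∩⁻ {K′ z} zK)) (∈∁mem⁻ a) e) b
    ... | inj₂ i with walks (proj₁ (∈∩⁻ {K′ z} zK)) | turn-pred (proj₁ m) (succs⊆ i)
    ... | L , W , u , L⊆ | M , t = ⊥-elim (max-insert (max-turn m t) W u
      (λ v∈ → ∉-turn (avoid (L⊆ v∈)) t) (~-sym (proj₁ (∈∩⁻ {adj G x (pred D w)} i))) e)

  -- Here k ≤ 5 and x has degree at least four. Two neighbours off D form a cherry with x. With
  -- none, |D| ≥ 8 exceeds k + 1. With exactly one, |D| ≥ 6 forces k = 5, only two vertices are off
  -- D, and `no-edge` applies.
  q≡3-absurd : q ≡ 3 → ∀ {D x} → Max D → k ≤ length D → x ∉ D → ⊥
  q≡3-absurd refl {D} {x} m k≤ x∉ with 2 ≤? offDeg x D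
  ... | yes off≥2 with #-nonempty {p = offNbrs x D} (≤-trans (s≤s z≤n) off≥2)
  ... | y , yi with #-another {p = offNbrs x D} y off≥2
  ... | z , zi , z≢y = no-cherry m k≤ (z≢y ∘ sym) (~-sym (proj₁ (∈offNbrs⁻ {D} yi))) (proj₁ (∈offNbrs⁻ {D} zi))
    (proj₂ (∈offNbrs⁻ {D} yi)) x∉ (proj₂ (∈offNbrs⁻ {D} zi))
        (+-mono-≤ (two (proj₂ (∈offNbrs⁻ {D} yi))) (two (proj₂ (∈offNbrs⁻ {D} zi))))
    where
    two : ∀ {v} → v ∉ D → offDeg v D ≤ 2
    two v∉ = ≤-pred (≤-trans (offDeg< v∉) (#-outside≤ (proj₁ m) k≤))
  q≡3-absurd refl {D} {x} m k≤ x∉ | no off≱2 with 1 ≤? offDeg x D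
  ... | no off≱1 = ≤-absurd 1 (≤-trans
      (*-monoʳ-≤ 2 (≤-trans (deg≥ x D)
          (≤-reflexive (trans (cong (onDeg x D +_) (n<1⇒n≡0 (≰⇒> off≱1))) (+-identityʳ _)))))
        (≤-trans (onDeg-≤ m x∉) (≤-trans (c-bound D (proj₁ m)) (s≤s (+-cancelʳ-≤ 4 k 5 k+4≤3q))))) refl
  ... | yes off≥1 with #-nonempty {p = offNbrs x D} off≥1
  ... | y , yi = no-edge m l (proj₁ (∈offNbrs⁻ {D} yi)) x∉ (proj₂ (∈offNbrs⁻ {D} yi))
      (+-mono-≤ off≤1 (≤-pred (≤-trans (offDeg< (proj₂ (∈offNbrs⁻ {D} yi)))
                     (≤-trans out≤2 (s≤s (s≤s z≤n))))))
    where
    off≤1 : offDeg x D ≤ 1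
    off≤1 = ≤-pred (≰⇒> off≱2)
    on≥3 : 3 ≤ onDeg x D
    on≥3 = +-cancelʳ-≤ 1 3 _ (≤-trans (deg≥ x D) (+-monoʳ-≤ (onDeg x D) off≤1))
    k≤5 : k ≤ 5
    k≤5 = +-cancelʳ-≤ 4 k 5 k+4≤3q
    l : length D ≡ suc k
    l = ≤-antisym (c-bound D (proj₁ m)) (≤-trans (s≤s k≤5) (≤-trans (*-monoʳ-≤ 2 on≥3) (onDeg-≤ m x∉)))
    out≤2 : # (∁ᵇ (mem D)) ≤ 2
    out≤2 = +-cancelˡ-≤ (suc k) _ 2
        (≤-reflexive (trans (cong (_+ # (∁ᵇ (mem D))) (sym l))
            (trans (#-∁mem (proj₁ m)) (trans (sym k+q≡n) (+-suc k 2)))))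

  absurd : ⊥
  absurd with #-choose-⊆ fullᵇ q
                (≤-trans (m≤n+m q k) (≤-reflexive (trans k+q≡n (sym #-full))))
  ... | X , _ , #X = maxCycle #X λ D m k≤ _ →
    let x , x∉ = #-nonempty {p = ∁ᵇ (mem D)} (≤-trans (s≤s z≤n) (≤-pred (≤-trans 3≤q (#-outside≥ (proj₁ m))))) in
    [ (λ lt → outside-absurd lt n {K = fullᵇ} m k≤ (∈∁mem⁻ x∉) tt (λ _ _ _ _ _ → tt) (#≤n (fullᵇ {n})))
    , (λ e → q≡3-absurd (sym e) m k≤ (∈∁mem⁻ x∉)) ]′ (m≤n⇒m<n∨m≡n 3≤q)

-- Orders in which every vertex off a cycle has an earlier and a later neighbour

module _ {A : Set} where

  -- Encoded by sublists, so that the relation survives the insertion of further vertices into O.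
  Before : List A → A → A → Set
  Before O a z = a ∷ z ∷ [] ⊆ O

  before-total : ∀ {O} {u v : A} → u ∈ O → v ∈ O → u ≢ v → Before O u v ⊎ Before O v u
  before-total (here refl) (here refl) ne = ⊥-elim (ne refl)
  before-total (here refl) (there j)   ne = inj₁ (refl ∷ from∈ j)
  before-total (there i)   (here refl) ne = inj₂ (refl ∷ from∈ i)
  before-total (there i)   (there j)   ne = [ (λ s → inj₁ (_ ∷ʳ s)) , (λ s → inj₂ (_ ∷ʳ s)) ]′ (before-total i j ne)

  before-split : ∀ {O} {u v : A} → Before O u v → ∃₂ λ O₁ O₂ → O ≡ O₁ ++ u ∷ O₂ × v ∈ O₂
  before-split (x ∷ʳ s) with before-split s
  ... | O₁ , O₂ , e , i = x ∷ O₁ , O₂ , cong (x ∷_) e , i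
  before-split (refl ∷ s) = [] , _ , refl , to∈ s

  before-pairs : ∀ {R : A → A → Set} O → (∀ {a b} → Before O a b → R a b) → AllPairs R O
  before-pairs []      h = []
  before-pairs (x ∷ O) h = All.tabulate (λ i → h (refl ∷ from∈ i)) ∷ before-pairs O (h ∘ (x ∷ʳ_))

module _ {n : ℕ} where

  index : Fin n → List (Fin n) → ℕ
  index z [] = 0
  index z (a ∷ L) with z ≟ a
  ... | yes _ = 0
  ... | no _  = suc (index z L)

  index-there : ∀ {z a L} → z ≢ a → index z (a ∷ L) ≡ suc (index z L)
  index-there {z} {a} ne with z ≟ a
  ... | yes e = ⊥-elim (ne e)
  ... | no _  = refl

  index-here : ∀ z L → index z (z ∷ L) ≡ 0
  index-here z L with z ≟ z
  ... | yes _ = refl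
  ... | no ne = ⊥-elim (ne refl)

  index-before : ∀ {O a z} → Unique O → Before O a z → index a O < index z O
  index-before {x ∷ O} {a} {z} u (.x ∷ʳ s) = subst₂ _<_
    (sym (index-there {a} {x} λ { refl → unique-∉ u (SL.Any-resp-⊆ s (here refl)) }))
    (sym (index-there {z} {x} λ { refl → unique-∉ u (SL.Any-resp-⊆ s (there (here refl))) }))
    (s≤s (index-before (unique-tail u) s))
  index-before {x ∷ O} {a} {z} u (refl ∷ s) = subst₂ _<_ (sym (index-here a O))
    (sym (index-there {z} {x} λ { refl → unique-∉ u (to∈ s) })) (s≤s z≤n)

  index-< : ∀ {O z} → z ∈ O → index z O < length O
  index-< {x ∷ O} {z} i with z ≟ x
  ... | yes _ = s≤s z≤n
  ... | no ne with i
  ... | here e  = ⊥-elim (ne e)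
  ... | there j = s≤s (index-< j)

  first-in : ∀ (O : List (Fin n)) L {a} → a ∈ L → a ∈ O →
    ∃ λ F → ∃₂ λ u T → L ≡ F ++ u ∷ T × u ∈ O × (∀ {z} → z ∈ F → z ∉ O)
  first-in O (x ∷ L) i aO with ∈-dec x O
  ... | inj₁ xO = [] , x , L , refl , xO , λ ()
  first-in O (x ∷ L) (here refl) aO | inj₂ x∉ = ⊥-elim (x∉ aO)
  first-in O (x ∷ L) (there i) aO | inj₂ x∉ with first-in O L i aO
  ... | F , u , T , e , uO , d = x ∷ F , u , T , cong (x ∷_) e , uO , λ { (here refl) → x∉ ; (there j) → d j }

  last-in : ∀ (O : List (Fin n)) L {a} → a ∈ L → a ∈ O →
    ∃ λ M → ∃₂ λ v B → L ≡ M ++ v ∷ B × v ∈ O × (∀ {z} → z ∈ B → z ∉ O)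
  last-in O L {a} i aO with first-in O (reverse L) (∈-resp-↭ (↭-sym (↭-reverse L)) i) aO
  ... | F , u , T , e , uO , d = reverse T , u , reverse F , eq , uO , λ j → d (∈-resp-↭ (↭-reverse F) j)
    where
    eq : L ≡ reverse T ++ u ∷ reverse F
    eq = trans (sym (L.reverse-involutive L)) (trans (cong reverse e)
      (trans (L.reverse-++ F (u ∷ T))
          (trans (cong (_++ reverse F) (L.unfold-reverse u T)) (L.++-assoc (reverse T) _ _))))

module LinearOrder {n : ℕ} (G : Graph n) (k : ℕ) (3≤k : 3 ≤ k) (k≤n : k ≤ n) (cyclable : KCyclable k G)
               {D : List (Fin n)} (cycleD : IsCycle G D) where
  open Cycles G
  open Turn

  record Ear (O : List (Fin n)) : Set where
    field
      {u v}    : Fin n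
      P        : List (Fin n)
      u∈       : u ∈ O
      v∈       : v ∈ O
      u≢v      : u ≢ v
      nonempty : ∃ λ x → x ∈ P
      unique   : Unique P
      disjoint : ∀ {z} → z ∈ P → z ∉ O
      walk     : Walk u v (u ∷ P ++ v ∷ [])

  ear-reverse : ∀ {O} (e : Ear O) → Walk (Ear.v e) (Ear.u e) (Ear.v e ∷ reverse (Ear.P e) ++ Ear.u e ∷ [])
  ear-reverse e = subst (Walk v u)
      (trans (L.unfold-reverse u (P ++ v ∷ [])) (cong (_++ u ∷ []) (L.reverse-++ P (v ∷ []))))
                    (walk-reverse walk)
    where open Ear e

  -- Because 3 ≤ k, some cycle passes through x, a and b. Cut open at x, it meets O at least twice,
  -- and the arc around x from the last of these vertices to the first is the ear.
  ear : ∀ {O a b x} → a ∈ O → b ∈ O → a ≢ b → x ∉ O → Ear O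
  ear {O} {a} {b} {x} aO bO a≢b x∉
    with #-choose (mem (x ∷ a ∷ b ∷ [])) fullᵇ k (λ _ _ → tt)
           (≤-trans (≤-reflexive (#-mem (((λ { refl → x∉ aO }) ∷ (λ { refl → x∉ bO }) ∷ []) ∷ (a≢b ∷ []) ∷ [] ∷ []))) 3≤k)
           (≤-trans k≤n (≤-reflexive (sym #-full)))
  ... | S , P⊆S , _ , #S with cyclable (toSubset S) (trans (∣toSubset∣ S) #S)
  ... | C , c , h with turn-to c (h x (∈-toSubset⁺ {p = S} (P⊆S x (mem⁺ (here refl)))))
  ... | M , t = go (in-M aO (there (here refl))) (in-M bO (there (there (here refl))))
    where
    in-M : ∀ {y} → y ∈ O → y ∈ x ∷ a ∷ b ∷ [] → y ∈ M
    in-M {y} yO i with sup t (h y (∈-toSubset⁺ {p = S} (P⊆S y (mem⁺ i))))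
    ... | here refl = ⊥-elim (x∉ yO)
    ... | there j   = j
    go : a ∈ M → b ∈ M → Ear O
    go aM bM with first-in O M aM aO
    ... | F , u , T , refl , uO , F∉ = second
      where
      tail-or : ∀ {y} → y ∈ F ++ u ∷ T → y ∈ O → y ≡ u ⊎ y ∈ T
      tail-or i yO with ∈-++⁻ F i
      ... | inj₁ j         = ⊥-elim (F∉ j yO)
      ... | inj₂ (here e)  = inj₁ e
      ... | inj₂ (there j) = inj₂ j
      -- The ear starts at the last vertex v of O, runs through `B` across the seam to x, and on
      -- through `F` to u.
      build : ∀ {y} → y ∈ T → y ∈ O → Ear O
      build yT yO with last-in O T yT yO
      ... | M′ , v , B , refl , vO , B∉ with cycle⇒walk (cycle t)
      ... | z , w , e with walk-prefix F w
      ... | y , wF , e′ = record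
        { P = B ++ x ∷ F ; u∈ = vO ; v∈ = uO
        ; u≢v = λ { refl → proj₂ (proj₂ (unique-++⁻ (x ∷ F ++ u ∷ M′) uC)) (∈-++⁺ʳ (x ∷ F) (here refl)) (here refl) }
        ; nonempty = x , ∈-++⁺ʳ B (here refl)
        ; unique = unique-++⁺ (unique-tail (proj₁ (proj₂ (unique-++⁻ (x ∷ F ++ u ∷ M′) uC))))
            (proj₁ (unique-++⁻ (x ∷ F) (cycle-unique (cycle t))))
            λ i j → proj₂ (proj₂ (unique-++⁻ (x ∷ F ++ u ∷ M′) uC)) (∈-++⁺ˡ j) (there i)
        ; disjoint = λ i → [ B∉ , (λ { (here refl) → x∉ ; (there j) → F∉ j }) ]′ (∈-++⁻ B i)
        ; walk = subst (Walk v u) (cong (v ∷_) (sym (L.++-assoc B (x ∷ F) (u ∷ []))))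
            (walk-++ (walk-suffix (x ∷ F ++ u ∷ M′) (subst (λ l → Walk x z (x ∷ l)) reassoc w)) e
                (walk-++ wF e′ (single u))) }
        where
        reassoc : F ++ u ∷ M′ ++ v ∷ B ≡ (F ++ u ∷ M′) ++ v ∷ B
        reassoc = sym (L.++-assoc F (u ∷ M′) (v ∷ B))
        uC : Unique ((x ∷ F ++ u ∷ M′) ++ v ∷ B)
        uC = subst (λ l → Unique (x ∷ l)) reassoc (cycle-unique (cycle t))
      second : Ear O
      second with tail-or aM aO | tail-or bM bO
      ... | inj₂ i    | _         = build i aO
      ... | inj₁ _    | inj₂ j    = build j bO
      ... | inj₁ refl | inj₁ refl = ⊥-elim (a≢b refl)

  walk-before : ∀ {u v z W} → Walk u v W → z ∈ W → z ≡ u ⊎ ∃ λ a → a ~ z × Before W a z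
  walk-before (single _) (here refl) = inj₁ refl
  walk-before (_ ∷ʷ _)   (here refl) = inj₁ refl
  walk-before (_∷ʷ_ {a} e w) (there i) with walk-before w i
  ... | inj₁ refl         = inj₂ (a , e , refl ∷ from∈ i)
  ... | inj₂ (b , e′ , s) = inj₂ (b , e′ , _ ∷ʳ s)

  walk-after : ∀ {u v z W} → Walk u v W → z ∈ W → z ≡ v ⊎ ∃ λ b → z ~ b × Before W z b
  walk-after (single _) (here refl) = inj₁ refl
  walk-after (_∷ʷ_ {b = b} e w) (here refl) with walk-∷ w
  ... | _ , refl = inj₂ (b , e , refl ∷ from∈ (here refl))
  walk-after (_ ∷ʷ w) (there i) with walk-after w i
  ... | inj₁ e            = inj₁ e
  ... | inj₂ (b , e′ , s) = inj₂ (b , e′ , _ ∷ʳ s)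

  -- The analogue of an st-numbering, with all of D in the role of the two terminals.
  record Ordering (O : List (Fin n)) : Set where
    field
      unique  : Unique O
      base    : ∀ {v} → v ∈ D → v ∈ O
      earlier : ∀ {z} → z ∈ O → z ∉ D → ∃ λ a → a ~ z × Before O a z
      later   : ∀ {z} → z ∈ O → z ∉ D → ∃ λ b → z ~ b × Before O z b

  -- The interior of the ear is placed directly behind u, hence before v. Each new vertex then has
  -- its neighbours on the ear on either side of it, while old vertices keep their witnesses.
  insert : ∀ {O u v P} → Ordering O → Before O u v → u ∈ O → v ∈ O → Unique P → (∀ {z} → z ∈ P → z ∉ O) →
    Walk u v (u ∷ P ++ v ∷ []) → ∃ λ O′ → Ordering O′ × length O′ ≡ length P + length O
  insert {O} {u} {v} {P} o b u∈ v∈ uP disj w with before-split b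
  ... | O₁ , O₂ , refl , vO₂ = O′ , record
    { unique  = unique-resp-↭ (↭-sym perm) (unique-++⁺ uP unique disj)
    ; base    = λ i → ∈-resp-↭ (↭-sym perm) (∈-++⁺ʳ P (base i))
    ; earlier = λ i z∉ → [ (λ j → lift (new-before j)) , (λ j → let a , e , s = earlier j z∉ in a , e , ⊆-trans s O⊆) ]′ (∈-++⁻ P (∈-resp-↭ perm i))
    ; later   = λ i z∉ → [ (λ j → lift′ (new-after j)) , (λ j → let a , e , s = later j z∉ in a , e , ⊆-trans s O⊆) ]′ (∈-++⁻ P (∈-resp-↭ perm i)) }
    , trans (↭-length perm) (L.length-++ P)
    where
    open Ordering o
    O′ = O₁ ++ u ∷ P ++ O₂
    perm : O′ ↭ P ++ O₁ ++ u ∷ O₂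
    perm = subst₂ _↭_ (L.++-assoc O₁ (u ∷ []) (P ++ O₂)) (cong (P ++_) (L.++-assoc O₁ (u ∷ []) O₂))
        (shifts (O₁ ++ u ∷ []) P {O₂})
    O⊆ : O₁ ++ u ∷ O₂ ⊆ O′
    O⊆ = SL.++⁺ (⊆-refl {x = O₁}) (refl ∷ SL.++⁺ˡ P ⊆-refl)
    W⊆ : u ∷ P ++ v ∷ [] ⊆ O′
    W⊆ = SL.++⁺ˡ O₁ (refl ∷ SL.++⁺ (⊆-refl {x = P}) (from∈ vO₂))
    lift : ∀ {z} → (∃ λ a → a ~ z × Before (u ∷ P ++ v ∷ []) a z) → ∃ λ a → a ~ z × Before O′ a z
    lift (a , e , s) = a , e , ⊆-trans s W⊆
    lift′ : ∀ {z} → (∃ λ a → z ~ a × Before (u ∷ P ++ v ∷ []) z a) → ∃ λ a → z ~ a × Before O′ z a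
    lift′ (a , e , s) = a , e , ⊆-trans s W⊆
    new-before : ∀ {z} → z ∈ P → ∃ λ a → a ~ z × Before (u ∷ P ++ v ∷ []) a z
    new-before i = [ (λ { refl → ⊥-elim (disj i u∈) }) , id ]′ (walk-before w (there (∈-++⁺ˡ i)))
    new-after : ∀ {z} → z ∈ P → ∃ λ a → z ~ a × Before (u ∷ P ++ v ∷ []) z a
    new-after i = [ (λ { refl → ⊥-elim (disj i v∈) }) , id ]′ (walk-after w (there (∈-++⁺ˡ i)))

  missing : (O : List (Fin n)) → (∃ λ x → x ∉ O) ⊎ (∀ v → v ∈ O)
  missing O with any? (λ x → T? (not (mem O x)))
  ... | yes (x , i) = inj₁ (x , λ j → T-not⇒¬T {mem O x} i (mem⁺ j))
  ... | no ¬r = inj₂ λ v → [ id , (λ h → ⊥-elim (¬r (v , ¬T⇒T-not (h ∘ mem⁻ {L = O})))) ]′ (∈-dec v O)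

  two-members : ∀ {D} → IsCycle G D → ∃₂ λ a b → a ∈ D × b ∈ D × a ≢ b
  two-members {a ∷ []} (s≤s () , _)
  two-members {a ∷ b ∷ _} (_ , (ne ∷ _) ∷ _ , _) = a , b , here refl , there (here refl) , ne

  add-ear : ∀ {O} → Ordering O → Ear O → ∃ λ O′ → Ordering O′ × length O < length O′
  add-ear {O} o e = [ forward , backward ]′ (before-total u∈ v∈ u≢v)
    where
    open Ear e
    longer : ∀ {l} P → (∃ λ x → x ∈ P) → l ≡ length P + length O → length O < l
    longer []      (_ , ()) _
    longer (y ∷ P) _ refl = s≤s (m≤n+m (length O) (length P))
    forward : Before O u v → ∃ λ O′ → Ordering O′ × length O < length O′
    forward b = let O′ , o′ , l = insert o b u∈ v∈ unique disjoint walk in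
      O′ , o′ , longer P nonempty l
    backward : Before O v u → ∃ λ O′ → Ordering O′ × length O < length O′
    backward b =
      let O′ , o′ , l = insert o b v∈ u∈ (unique-resp-↭ (↭-sym (↭-reverse P)) unique)
                          (λ i → disjoint (∈-resp-↭ (↭-reverse P) i)) (ear-reverse e)
      in O′ , o′ , longer (reverse P) (proj₁ nonempty , ∈-resp-↭ (↭-sym (↭-reverse P)) (proj₂ nonempty)) l

  opaque
    enlarge : ∀ {O x} → Ordering O → x ∉ O → ∃ λ O′ → Ordering O′ × length O < length O′
    enlarge o x∉ = let a , b , aD , bD , ne = two-members cycleD in
      add-ear o (ear (Ordering.base o aD) (Ordering.base o bD) ne x∉)

  room : ∀ {O} {x : Fin n} → Unique O → x ∉ O → length O < n
  room {O} {x} u x∉ = ≤-trans (unique-length≤ {L = x ∷ O} {p = fullᵇ} (unique-∷ x∉ u) (λ _ → tt)) (#≤n (fullᵇ {n}))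

  complete : ∀ f O → Ordering O → n ≤ length O + f → ∃ λ O′ → Ordering O′ × (∀ v → v ∈ O′)
  complete f O o le with missing O
  ... | inj₂ all = O , o , all
  complete zero O o le | inj₁ (x , x∉) = ⊥-elim
      (<⇒≱ (room (Ordering.unique o) x∉) (subst (n ≤_) (+-identityʳ (length O)) le))
  complete (suc f) O o le | inj₁ (x , x∉) = let O′ , o′ , lt = enlarge o x∉ in
    complete f O′ o′ (≤-trans le (≤-trans (≤-reflexive (+-suc (length O) f)) (+-monoˡ-≤ f lt)))

  start : Ordering D
  start = record
    { unique = cycle-unique cycleD ; base = id
    ; earlier = λ i h → ⊥-elim (h i) ; later = λ i h → ⊥-elim (h i) }

  ordering : ∃ λ O → Ordering O × (∀ v → v ∈ O)
  ordering = complete n D start (m≤n+m n (length D))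

-- Pigeonhole, peeling off the top colour: if its class has at most b members, more than m * b
-- vertices are left for the other m colours.
#-classes : ∀ {n} (p : BSet n) (col : Fin n → ℕ) m b → (∀ v → v ∈ᵇ p → col v < m) → m * b < # p →
  ∃ λ j → b < # (p ∩ᵇ λ v → ⌊ col v ℕ.≟ j ⌋)
#-classes p col zero b h lt with #-nonempty {p = p} lt
... | v , i with h v i
... | ()
#-classes {n} p col (suc m) b h lt with b <? # (p ∩ᵇ λ v → ⌊ col v ℕ.≟ m ⌋)
... | yes l = m , l
... | no ¬l = let j , l = #-classes p′ col m b h′ lt′ in
    j , ≤-trans l (#-mono λ v i → let a , c = ∈∩⁻ {p′ v} i in ∈∩⁺ (proj₁ (∈∩⁻ {p v} a)) c)
  where
  top p′ : BSet n
  top v = ⌊ col v ℕ.≟ m ⌋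
  p′ = p ∩ᵇ ∁ᵇ top
  h′ : ∀ v → v ∈ᵇ p′ → col v < m
  h′ v i = let a , c = ∈∩⁻ {p v} i in ≤∧≢⇒< (≤-pred (h v a)) λ e → T-not⇒¬T c (fromWitness e)
  lt′ : m * b < # p′
  lt′ = +-cancelˡ-≤ b _ _ (≤-trans (≤-reflexive (+-suc b (m * b)))
    (≤-trans lt (≤-trans (≤-reflexive (#-split p top)) (+-monoˡ-≤ (# p′) (≮⇒≥ ¬l)))))

-- Part (i): rising paths off a longest cycle

module LongestCycle {n : ℕ} (G : Graph n) (k : ℕ) (3≤k : 3 ≤ k) (k≤n : k ≤ n) (cyclable : KCyclable k G)
                 {D : List (Fin n)} (cycleD : IsCycle G D) (longest : ∀ C → IsCycle G C → length C ≤ length D)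
                 (D<2k : length D < 2 * k) where
  open Cycles G
  open Turn
  open Windows G
  open Outside G
  open LinearOrder G k 3≤k k≤n cyclable cycleD

  maxD : Max D
  maxD = cycleD , λ C c lt _ → <⇒≱ lt (longest C c)

  -- Some cycle contains k vertices of p, no two of them consecutive; it has at least 2k vertices,
  -- more than D.
  no-independent : ∀ {p} → Independent p → k ≤ # p → ⊥
  no-independent {p} ind k≤p
    with #-choose-⊆ p k k≤p
  ... | S , S⊆p , #S with cyclable (toSubset S) (trans (∣toSubset∣ S) #S)
  ... | C , c , h = <⇒≱ D<2k (≤-trans
    (*-monoʳ-≤ 2 (≤-trans (≤-reflexive (sym #S))
        (#-mono {p = S} {q = S ∩ᵇ mem C} λ v i → ∈∩⁺ i (mem⁺ (h v (∈-toSubset⁺ {p = S} i))))))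
    (≤-trans (independent-cycle {p = S} (λ u v i j → ind u v (S⊆p u i) (S⊆p v j)) c) (longest C c)))

  -- Otherwise x and its successors on D would supply k independent vertices.
  onDeg-small : ∀ {x} → x ∉ D → onDeg x D + 2 ≤ k
  onDeg-small {x} x∉ with onDeg x D + 2 ≤? k
  ... | yes h = h
  ... | no h = ⊥-elim (no-independent (starSet-independent maxD x∉)
    (≤-trans (≤-pred (≤-trans (≰⇒> h) (≤-reflexive (+-comm (onDeg x D) 2))))
        (≤-reflexive (sym (#-starSet cycleD x∉)))))

  -- The ear is at most as long as each of the two arcs of D it could replace.
  ear-length : ∀ {d d′ a b P} → d ∈ D → d′ ∈ D → d ≢ d′ → d ~ a → b ~ d′ → Walk a b P → Unique P →
    (∀ {z} → z ∈ P → z ∉ D) → length P + 2 ≤ k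
  ear-length {d} {d′} {a} {b} {P} dD d′D ne e e′ w u disj with turn-to cycleD dD
  ... | M , t with sup t d′D
  ... | here refl = ⊥-elim (ne refl)
  ... | there i with ∈-∃++ i
  -- Both arcs together give 2|P| + 2 ≤ |D| < 2k, which is then halved.
  ... | A , B , refl = half (≤-<-trans
      (≤-trans (≤-reflexive (lem (length P))) (≤-trans (+-monoˡ-≤ 2 (+-mono-≤ P≤A P≤B)) (≤-reflexive |D|))) D<2k)
    where
    open ≤-Reasoning
    |D| : length A + length B + 2 ≡ length D
    |D| = trans (lem′ (length A) (length B)) (trans (cong suc (sym (L.length-++ A))) (len t))
      where
      lem′ : ∀ x y → x + y + 2 ≡ suc (x + suc y)
      lem′ = solve-∀
    lem : ∀ x → 2 * suc x ≡ x + x + 2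
    lem = solve-∀
    arc : ∀ {v v′} M M′ P → Turn D (v ∷ M ++ v′ ∷ M′) → IsCycle G (v ∷ P ++ v′ ∷ M′) → length P ≤ length M
    arc {v} {v′} M M′ P t c = +-cancelʳ-≤ (suc (length M′)) _ _ (≤-pred (begin
      suc (length P + suc (length M′))     ≡⟨ cong suc (L.length-++ P) ⟨
      length (v ∷ P ++ v′ ∷ M′)            ≤⟨ longest _ c ⟩
      length D                             ≡⟨ len t ⟨
      length (v ∷ M ++ v′ ∷ M′)            ≡⟨ cong suc (L.length-++ M) ⟩
      suc (length M + suc (length M′))     ∎))
    P≤A : length P ≤ length A
    P≤A = arc A B P t (bypass A B (cycle t) w u (λ i → ∉-turn (disj i) t) e e′)
    t′ : Turn D (d′ ∷ B ++ d ∷ A)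
    t′ = rotate-closed (Turn D) turn-rot (d ∷ A) (d′ ∷ B) t
    P≤B : length P ≤ length B
    P≤B = subst (_≤ length B) (↭-length (↭-reverse P)) (arc B A (reverse P) t′
      (bypass B A (cycle t′) (walk-reverse w) (unique-resp-↭ (↭-sym (↭-reverse P)) u)
        (λ i → ∉-turn (disj (∈-resp-↭ (↭-reverse P) i)) t′) (~-sym e′) (~-sym e)))
    half : 2 * suc (length P) < 2 * k → length P + 2 ≤ k
    half lt = subst (_≤ k) (+-comm 2 (length P)) (*-cancelˡ-< 2 _ _ lt)

  module Ranked {O : List (Fin n)} (o : Ordering O) (all : ∀ v → v ∈ O) where
    open Ordering o

    rank : Fin n → ℕ
    rank v = index v O

    data Rising : Fin n → Fin n → List (Fin n) → Set where
      one  : ∀ {z} → z ∉ D → Rising z z (z ∷ [])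
      step : ∀ {z z′ y L} → z ∉ D → z ~ z′ → rank z < rank z′ → Rising z′ y L → Rising z y (z ∷ L)

    rising-walk : ∀ {z y L} → Rising z y L → Walk z y L
    rising-walk (one _)        = single _
    rising-walk (step _ e _ r) = e ∷ʷ rising-walk r

    rising-avoid : ∀ {z y L} → Rising z y L → ∀ {v} → v ∈ L → v ∉ D
    rising-avoid (one h)        (here refl) = h
    rising-avoid (step h _ _ _) (here refl) = h
    rising-avoid (step _ _ _ r) (there i)   = rising-avoid r i

    rising-rank : ∀ {z y L} → Rising z y L → ∀ {v} → v ∈ L → rank z ≤ rank v
    rising-rank (one h)         (here refl) = ≤-refl
    rising-rank (step h _ _ _)  (here refl) = ≤-refl
    rising-rank (step _ _ lt r) (there i)   = ≤-trans (<⇒≤ lt) (rising-rank r i)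

    rising-start : ∀ {z y L} → Rising z y L → z ∈ L
    rising-start (one _)        = here refl
    rising-start (step _ _ _ _) = here refl

    rising-end : ∀ {z y L} → Rising z y L → y ∈ L
    rising-end (one _)        = here refl
    rising-end (step _ _ _ r) = there (rising-end r)

    rising-unique : ∀ {z y L} → Rising z y L → Unique L
    rising-unique (one _)         = [] ∷ []
    rising-unique (step _ _ lt r) = unique-∷ (λ i → <⇒≱ lt (rising-rank r i)) (rising-unique r)

    rising-snoc : ∀ {z y L b} → Rising z y L → y ~ b → rank y < rank b → b ∉ D → Rising z b (L ++ b ∷ [])
    rising-snoc (one h)         e l b∉ = step h e l (one b∉)
    rising-snoc (step h e′ l′ r) e l b∉ = step h e′ l′ (rising-snoc r e l b∉)

    RisingEar : ℕ → Set
    RisingEar m = ∃₂ λ z y → ∃₂ λ L d → ∃ λ d′ → Rising z y L × m ≤ length L × d ∈ D × d′ ∈ D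
      × d ~ z × y ~ d′ × rank d < rank z × rank y < rank d′

    -- Earlier neighbours are prepended until one lies on D. The rank of the first vertex drops each
    -- time, so its bound `f` serves as fuel.
    extend-down : ∀ f {z y L d′} → rank z ≤ f → Rising z y L → d′ ∈ D → y ~ d′ → rank y < rank d′ →
        RisingEar (length L)
    extend-down f {z} {y} {L} {d′} le r d′D e′ l′ with earlier (all z) (rising-avoid r (rising-start r))
    ... | a , e , b with ∈-dec a D | index-before unique b
    ... | inj₁ aD | lt = z , y , L , a , d′ , r , ≤-refl , aD , d′D , e , e′ , lt , l′
    extend-down zero le r d′D e′ l′ | a , e , b | inj₂ a∉ | lt = ⊥-elim (<⇒≱ (≤-trans (s≤s z≤n) lt) le)
    extend-down (suc f) le r d′D e′ l′ | a , e , b | inj₂ a∉ | lt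
      with extend-down f (≤-pred (≤-trans lt le)) (step a∉ e lt r) d′D e′ l′
    ... | z , y , L , d , d′ , r′ , m , rest = z , y , L , d , d′ , r′ , ≤-trans (n≤1+n _) m , rest

    extend-up : ∀ f {z y L} → length O ≤ rank y + f → Rising z y L → RisingEar (length L)
    extend-up f {z} {y} {L} le r with later (all y) (rising-avoid r (rising-end r))
    ... | b , e , s with ∈-dec b D | index-before unique s
    ... | inj₁ bD | lt = extend-down (rank z) ≤-refl r bD e lt
    extend-up zero {y = y} le r | b , e , s | inj₂ b∉ | lt =
      ⊥-elim (<⇒≱ (index-< (all y)) (subst (length O ≤_) (+-identityʳ (rank y)) le))
    extend-up (suc f) {y = y} {L} le r | b , e , s | inj₂ b∉ | lt
      with extend-up f (≤-trans le (≤-trans (≤-reflexive (+-suc (rank y) f)) (+-monoˡ-≤ f lt))) (rising-snoc r e lt b∉)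
    ... | z , y , L′ , d , d′ , r′ , m , rest = z , y , L′ , d , d′ , r′ , ≤-trans
        (≤-trans (m≤m+n (length L) 1) (≤-reflexive (sym (L.length-++ L)))) m , rest

    -- Prolonged at both ends to D, the path becomes an ear. Its attachment vertices differ because
    -- the rank rises throughout, so `ear-length` applies.
    rising-length : ∀ {z y L} → Rising z y L → length L + 2 ≤ k
    rising-length {y = y} {L} r with extend-up (length O) (m≤n+m (length O) (rank y)) r
    ... | z′ , y′ , L′ , d , d′ , r′ , m , dD , d′D , e , e′ , l , l′ = ≤-trans (+-monoˡ-≤ 2 m)
      (ear-length dD d′D (λ { refl → <-irrefl refl (<-trans l (≤-<-trans (rising-rank r′ (rising-end r′)) l′)) })
        e e′ (rising-walk r′) (rising-unique r′) (rising-avoid r′))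

    -- Abstracts colouring by longest rising paths: each colour is realised by a path, which keeps
    -- colours few, and adjacent vertices differ, which makes classes independent.
    record Colouring (L : List (Fin n)) : Set where
      field
        colour : Fin n → ℕ
        rises  : ∀ {z} → z ∈ L → z ∉ D → ∃₂ λ y Y → Rising z y Y × length Y ≡ suc (colour z)
        proper : ∀ {z w} → z ∈ L → w ∈ L → z ∉ D → w ∉ D → z ~ w → colour z ≢ colour w

    argmax : ∀ (p : BSet n) (f : Fin n → ℕ) L → (∀ {w} → w ∈ L → w ∉ᵇ p) ⊎
      ∃ λ w → w ∈ L × w ∈ᵇ p × (∀ {w′} → w′ ∈ L → w′ ∈ᵇ p → f w′ ≤ f w)
    argmax p f [] = inj₁ λ ()
    argmax p f (x ∷ L) with T? (p x) | argmax p f L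
    ... | no h  | inj₁ none = inj₁ λ { (here refl) → h ; (there i) → none i }
    ... | no h  | inj₂ (w , i , pw , g) =
      inj₂ (w , there i , pw , λ { (here refl) px → ⊥-elim (h px) ; (there j) → g j })
    ... | yes h | inj₁ none =
      inj₂ (x , here refl , h , λ { (here refl) _ → ≤-refl ; (there j) pw → ⊥-elim (none j pw) })
    ... | yes h | inj₂ (w , i , pw , g) with ≤-total (f x) (f w)
    ... | inj₁ le = inj₂ (w , there i , pw , λ { (here refl) _ → le ; (there j) → g j })
    ... | inj₂ ge = inj₂ (x , here refl , h , λ { (here refl) _ → ≤-refl ; (there j) q → ≤-trans (g j q) ge })

    recolour : Fin n → ℕ → (Fin n → ℕ) → Fin n → ℕ
    recolour z c f v with v ≟ z
    ... | yes _ = c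
    ... | no _  = f v

    recolour-same : ∀ z c f → recolour z c f z ≡ c
    recolour-same z c f with z ≟ z
    ... | yes _ = refl
    ... | no h  = ⊥-elim (h refl)

    recolour-other : ∀ {z c f v} → v ≢ z → recolour z c f v ≡ f v
    recolour-other {z} {c} {f} {v} h with v ≟ z
    ... | yes e = ⊥-elim (h e)
    ... | no _  = refl

    -- Greedy, from the last vertex backwards: z gets one more than the largest colour among its
    -- later neighbours off D, and prefixing z to the path of a neighbour attaining the maximum
    -- realises this colour.
    colouring : ∀ L → AllPairs (λ a b → rank a < rank b) L → Colouring L
    colouring [] _ = record { colour = λ _ → 0 ; rises = λ () ; proper = λ () }
    colouring (z ∷ L) (z< ∷ ps) = choose (argmax p colour L)
      where
      open Colouring (colouring L ps)
      p : BSet n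
      p w = adj G z w ∧ not (mem D w)
      z≢ : ∀ {w} → w ∈ L → w ≢ z
      z≢ i refl = <-irrefl refl (All.lookup z< i)
      with-colour : ∀ c → (z ∉ D → ∃₂ λ y Y → Rising z y Y × length Y ≡ suc c) →
        (∀ {w} → w ∈ L → w ∈ᵇ p → colour w < c) → Colouring (z ∷ L)
      with-colour c up big = record
        { colour = f
        ; rises = λ { (here refl) z∉ → let y , Y , r , e = up z∉ in y , Y , r , trans e (cong suc (sym (recolour-same z c colour)))
                    ; (there i) w∉ → let y , Y , r , e = rises i w∉ in y , Y , r , trans e (cong suc (sym (recolour-other (z≢ i)))) }
        ; proper = λ { (here refl) (here refl) _ _ e → ⊥-elim (~-irrefl e)
                     ; (here refl) (there j) _ w∉ e q → differ j w∉ e (sym q)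
                     ; (there i) (here refl) v∉ _ e q → differ i v∉ (~-sym e) q
                     ; (there i) (there j) v∉ w∉ e q →
                         proper i j v∉ w∉ e (trans (sym (recolour-other (z≢ i)))
                             (trans q (recolour-other (z≢ j)))) } }
        where
        f = recolour z c colour
        differ : ∀ {w} → w ∈ L → w ∉ D → z ~ w → f w ≢ f z
        differ i w∉ e q = <-irrefl (trans (sym (recolour-other (z≢ i))) (trans q (recolour-same z c colour)))
            (big i (∈∩⁺ e (∈∁mem⁺ w∉)))
      choose : ((∀ {w} → w ∈ L → w ∉ᵇ p) ⊎ ∃ λ w →
          w ∈ L × w ∈ᵇ p × (∀ {w′} → w′ ∈ L → w′ ∈ᵇ p → colour w′ ≤ colour w)) → Colouring (z ∷ L)
      choose (inj₁ none) = with-colour 0 (λ z∉ → z , z ∷ [] , one z∉ , refl) (λ i h → ⊥-elim (none i h))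
      choose (inj₂ (w , i , pw , g)) = with-colour (suc (colour w))
        (λ z∉ → let e , h = ∈∩⁻ {adj G z w} pw ; y , Y , r , l = rises i (∈∁mem⁻ h) in
          y , z ∷ Y , step z∉ e (All.lookup z< i) r , cong suc l)
        (λ j h → s≤s (g j h))

    open Colouring (colouring O (before-pairs O (index-before unique))) public

    colour-bound : ∀ {z} → z ∉ D → suc (colour z) + 2 ≤ k
    colour-bound {z} z∉ = let y , Y , r , l = rises (all z) z∉ in subst (λ m → m + 2 ≤ k) l (rising-length r)

    outside : BSet n
    outside = ∁ᵇ (mem D)

    class : ℕ → BSet n
    class j = outside ∩ᵇ λ v → ⌊ colour v ℕ.≟ j ⌋

    class∉ : ∀ {j v} → v ∈ᵇ class j → v ∉ D
    class∉ {j} {v} i = ∈∁mem⁻ (proj₁ (∈∩⁻ {not (mem D v)} i))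

    class-independent : ∀ j → Independent (class j)
    class-independent j u v i i′ e = proper (all u) (all v) (class∉ {j} i) (class∉ {j} i′) e
      (trans (toWitness (proj₂ (∈∩⁻ {not (mem D u)} i))) (sym (toWitness (proj₂ (∈∩⁻ {not (mem D v)} i′)))))

    large-class : ∀ m b → m + 2 ≡ k → m * b < # outside → ∃ λ j → b < # (class j)
    large-class m b e lt = #-classes outside colour m b
      (λ v i → +-cancelʳ-≤ 2 _ _ (subst (suc (colour v) + 2 ≤_) (sym e) (colour-bound (∈∁mem⁻ i)))) lt

    size : length D + # outside ≡ n
    size = #-∁mem cycleD

    -- With more than (k - 2)(k - 1) vertices off D, one of k - 2 classes has k members. Otherwise n
    -- ≤ (2k - 1) + (k - 2)(k - 1) = k² - k + 1, which is below k² - 3 as soon as k ≥ 5.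
    case-≥5 : ∀ j → k ≡ 5 + j → k * k ≤ n + 3 → ⊥
    case-≥5 j refl k² with (3 + j) * (4 + j) <? # outside
    ... | yes lt = let i , l = large-class (3 + j) (4 + j) (+-comm (3 + j) 2) lt in no-independent (class-independent i) l
    ... | no ¬lt = ≤-absurd j (+-mono-≤ D<2k (+-mono-≤ (subst (λ n → k * k ≤ n + 3) (sym size) k²) (≮⇒≥ ¬lt)))
        (lem j (length D) (# outside))
      where
      lem : ∀ j l r → suc l + ((5 + j) * (5 + j) + r) ≡ suc (2 * (5 + j) + (l + r + 3 + (3 + j) * (4 + j)) + j)
      lem = solve-∀

    -- Since |D| ≤ 5, some x is off D. Only colour 0 is available, so x has both its earlier and its
    -- later neighbour on D, one more than `onDeg-small` permits.
    case-3 : k ≡ 3 → 6 ≤ n → ⊥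
    case-3 refl 6≤n with #-nonempty {p = outside} (+-cancelˡ-≤ 5 1 _ (≤-trans 6≤n (≤-trans (≤-reflexive (sym size)) (+-monoˡ-≤ _ (≤-pred D<2k)))))
    ... | x , x∈ = <⇒≱ (≤-trans (+-monoˡ-≤ 2 on≥2) (onDeg-small x∉)) ≤-refl
      where
      x∉ = ∈∁mem⁻ {D} x∈
      colour≡0 : ∀ {v} → v ∉ D → colour v ≡ 0
      colour≡0 h = n≤0⇒n≡0 (≤-pred (+-cancelʳ-≤ 2 _ 1 (colour-bound h)))
      nbr∈D : ∀ {v} → x ~ v → v ∈ D
      nbr∈D {v} e = [ id , (λ h → ⊥-elim
          (proper (all x) (all v) x∉ h e (trans (colour≡0 x∉) (sym (colour≡0 h))))) ]′ (∈-dec v D)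
      on≥2 : 2 ≤ onDeg x D
      on≥2 = let a , e , s = earlier (all x) x∉ ; b , e′ , s′ = later (all x) x∉ in
        subst (_≤ onDeg x D) (#-pair {a} {b} λ q → <-asym (index-before unique s)
            (subst (λ y → rank x < rank y) (sym q) (index-before unique s′)))
          (#-mono {p = ⁅ a ⁆ ∪ᵇ ⁅ b ⁆} λ v i → [ (λ j → on (subst (x ~_) (sym (∈⁅⁆⁻ j)) (~-sym e))) ,
              (λ j → on (subst (x ~_) (sym (∈⁅⁆⁻ j)) e′)) ]′ (∈∪⁻ {⁅ a ⁆ v} i))
        where
        on : ∀ {v} → x ~ v → v ∈ᵇ (adj G x ∩ᵇ mem D)
        on e = ∈∩⁺ e (mem⁺ (nbr∈D e))

    -- Three independent vertices off D have at most two neighbours each among the seven vertices of D.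
    case-4 : k ≡ 4 → 13 ≤ n → ⊥
    case-4 refl 13≤n with length D ≤? 6
    -- At least seven vertices off D share two colours, so four of them are independent.
    ... | yes l≤6 = let j , l = large-class 2 3 refl (+-cancelˡ-≤ 6 7 _ (≤-trans 13≤n (≤-trans (≤-reflexive (sym size)) (+-monoˡ-≤ _ l≤6)))) in
      no-independent (class-independent j) l
    ... | no l≰6 = let j , l = large-class 2 2 refl (≤-trans (n≤1+n 5) (+-cancelˡ-≤ 7 6 _ (≤-trans 13≤n (≤-trans (≤-reflexive (sym size)) (+-monoˡ-≤ _ (≤-pred D<2k)))))) in
      three j l
      where
      N : Fin n → BSet n
      N v = adj G v ∩ᵇ mem D
      N≤2 : ∀ j {v} → v ∈ᵇ class j → # (N v) ≤ 2
      N≤2 j i = +-cancelʳ-≤ 2 _ 2 (onDeg-small (class∉ {j} i))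
      few : ∀ j {v₁ v₂ v₃} → v₁ ∈ᵇ class j → v₂ ∈ᵇ class j → v₃ ∈ᵇ class j → # (N v₁ ∪ᵇ N v₂ ∪ᵇ N v₃) ≤ 6
      few j {v₁} {v₂} {v₃} i₁ i₂ i₃ = ≤-trans (#-cover {p = N v₁} {q = N v₂ ∪ᵇ N v₃} λ v → ∈∪⁻)
        (+-mono-≤ (N≤2 j i₁) (≤-trans (#-cover {p = N v₂} {q = N v₃} λ v → ∈∪⁻) (+-mono-≤ (N≤2 j i₂) (N≤2 j i₃))))
      three : ∀ j → 3 ≤ # (class j) → ⊥
      three j l with #-nonempty {p = class j} (≤-trans (s≤s z≤n) l)
      ... | v₁ , i₁ with #-another {p = class j} v₁ (≤-trans (s≤s (s≤s z≤n)) l)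
      ... | v₂ , i₂ , 2≢1 with #-pick {p = class j} {q = ⁅ v₁ ⁆ ∪ᵇ ⁅ v₂ ⁆} (≤-trans (s≤s (≤-reflexive (#-pair (2≢1 ∘ sym)))) l)
      ... | v₃ , i₃ , v₃∉ with #-pick {p = mem D} {q = N v₁ ∪ᵇ N v₂ ∪ᵇ N v₃}
                                 (≤-trans (s≤s (few j i₁ i₂ i₃))
                                     (≤-trans (≰⇒> l≰6) (≤-reflexive (sym (#-mem (cycle-unique cycleD))))))
      ... | z , zD , z∉ = no-independent {p = mem four} ind (≤-reflexive (sym (#-mem four-unique)))
        where
        four = z ∷ v₁ ∷ v₂ ∷ v₃ ∷ []
        z∈D = mem⁻ {L = D} zD
        z≢ : ∀ {v} → v ∈ᵇ class j → z ≢ v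
        z≢ i refl = class∉ {j} i z∈D
        four-unique : Unique four
        four-unique = (z≢ i₁ ∷ z≢ i₂ ∷ z≢ i₃ ∷ []) ∷ ((2≢1 ∘ sym) ∷ (λ { refl → v₃∉ (∈∪ˡ (∈⁅⁆ v₃)) }) ∷ [])
          ∷ ((λ { refl → v₃∉ (∈∪ʳ {⁅ v₁ ⁆ v₃} (∈⁅⁆ v₃)) }) ∷ []) ∷ [] ∷ []
        member : ∀ {v} → v ∈ four → v ≡ z ⊎ v ∈ᵇ class j × ¬ z ~ v
        member (here e) = inj₁ e
        member (there (here refl)) = inj₂ (i₁ , λ e → z∉ (∈∪ˡ (∈∩⁺ (~-sym e) zD)))
        member (there (there (here refl))) = inj₂
            (i₂ , λ e → z∉ (∈∪ʳ {adj G v₁ z ∧ mem D z} (∈∪ˡ (∈∩⁺ (~-sym e) zD))))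
        member (there (there (there (here refl)))) = inj₂
            (i₃ , λ e → z∉ (∈∪ʳ {adj G v₁ z ∧ mem D z} (∈∪ʳ {adj G v₂ z ∧ mem D z} (∈∩⁺ (~-sym e) zD))))
        ind : Independent (mem four)
        ind u v i i′ e with member (mem⁻ {L = four} i) | member (mem⁻ {L = four} i′)
        ... | inj₁ refl    | inj₁ refl     = ~-irrefl e
        ... | inj₁ refl    | inj₂ (_ , h)  = h e
        ... | inj₂ (_ , h) | inj₁ refl     = h (~-sym e)
        ... | inj₂ (a , _) | inj₂ (b , _)  = class-independent j u v a b e

  longest-absurd : k * k ≤ n + 3 → ⊥
  longest-absurd k² = let O , o , all = ordering in go k refl o all k²
    where
    go : ∀ k′ → k ≡ k′ → ∀ {O} → Ordering O → (∀ v → v ∈ O) → k′ * k′ ≤ n + 3 → ⊥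
    go 0 refl = case 3≤k of λ ()
    go 1 refl = case 3≤k of λ { (s≤s ()) }
    go 2 refl = case 3≤k of λ { (s≤s (s≤s ())) }
    go 3 e o all k² = Ranked.case-3 o all e (+-cancelʳ-≤ 3 6 n k²)
    go 4 e o all k² = Ranked.case-4 o all e (+-cancelʳ-≤ 3 13 n k²)
    go (suc (suc (suc (suc (suc j))))) e o all k² = Ranked.case-≥5 o all j e (subst (λ m → m * m ≤ n + 3) (sym e) k²)

-- The case k = 2: circumference three forces completeness

two-cyclable-absurd : ∀ {n} (G : Graph n) → 4 ≤ n → KCyclable 2 G → (∀ C → IsCycle G C → length C ≤ 3) → ⊥
two-cyclable-absurd {suc (suc (suc (suc n)))} G (s≤s (s≤s (s≤s (s≤s _)))) cyclable short =
  <⇒≱ (short square cycle) ≤-refl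
  where
  open Cycles G
  open Outside G
  -- A cycle through u and v has only three vertices, so they are consecutive on it.
  complete : ∀ u v → u ≢ v → u ~ v
  complete u v ne with cyclable (toSubset (⁅ u ⁆ ∪ᵇ ⁅ v ⁆)) (trans (∣toSubset∣ (⁅ u ⁆ ∪ᵇ ⁅ v ⁆)) (#-pair ne))
  ... | C , c , h = go (turn-to c (h u (∈-toSubset⁺ {p = ⁅ u ⁆ ∪ᵇ ⁅ v ⁆} (∈∪ˡ (∈⁅⁆ u)))))
    where
    go : (∃ λ M → Turn C (u ∷ M)) → u ~ v
    go (M , t) = near M (Turn.cycle t) (Turn.sup t (h v (∈-toSubset⁺ {p = ⁅ u ⁆ ∪ᵇ ⁅ v ⁆} (∈∪ʳ {⁅ u ⁆ v} (∈⁅⁆ v)))))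
      where
      near : ∀ M → IsCycle G (u ∷ M) → v ∈ u ∷ M → u ~ v
      near M c (here e) = ⊥-elim (ne (sym e))
      near (a ∷ M) c (there i) with cycle⇒walk c
      near (a ∷ M) c (there (here refl)) | _ , e ∷ʷ w , _ = subst (u ~_) (walk-head w) e
      near (a ∷ b ∷ []) c (there (there (here refl))) | z , w , e = ~-sym (subst (_~ u) (walk-last (u ∷ a ∷ []) w) e)
      near (a ∷ b ∷ d ∷ M) c (there (there _)) | _ = ⊥-elim (<⇒≱ (s≤s (s≤s (s≤s (s≤s z≤n)))) (short _ c))
  square = zero ∷ suc zero ∷ suc (suc zero) ∷ suc (suc (suc zero)) ∷ []
  cycle : IsCycle G square
  cycle = walk⇒cycle (complete _ _ (λ ()) ∷ʷ complete _ _ (λ ()) ∷ʷ complete _ _ (λ ()) ∷ʷ single _)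
      (complete _ _ λ ())
    (((λ ()) ∷ (λ ()) ∷ (λ ()) ∷ []) ∷ ((λ ()) ∷ (λ ()) ∷ []) ∷ ((λ ()) ∷ []) ∷ [] ∷ []) (s≤s (s≤s (s≤s z≤n)))

-- Complete bipartite graphs

completeBipartite : ∀ {n} → BSet n → Graph n
completeBipartite A = record
  { adj    = λ u v → A u xor A v
  ; sym    = λ u v → xor-comm (A u) (A v)
  ; irrefl = λ v → xor-same (A v) }

elements : ∀ {n} → BSet n → List (Fin n)
elements {n} p = filter (λ v → T? (p v)) (allFin n)

elements-unique : ∀ {n} (p : BSet n) → Unique (elements p)
elements-unique {n} p = U.filter⁺ (λ v → T? (p v)) (U.allFin⁺ n)

∈-elements⁺ : ∀ {n} {p : BSet n} {v} → v ∈ᵇ p → v ∈ elements p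
∈-elements⁺ {p = p} {v} h = ∈-filter⁺ (λ v → T? (p v)) (∈-allFin v) h

∈-elements⁻ : ∀ {n} {p : BSet n} {v} → v ∈ elements p → v ∈ᵇ p
∈-elements⁻ {n} {p} h = proj₂ (∈-filter⁻ (λ v → T? (p v)) {xs = allFin n} h)

length-elements : ∀ {n} (p : BSet n) → length (elements p) ≡ # p
length-elements p = trans (sym (#-mem (elements-unique p)))
  (#-cong (λ v i → ∈-elements⁻ {p = p} (mem⁻ {L = elements p} i)) (λ v i → mem⁺ (∈-elements⁺ {p = p} i)))

interleave : ∀ {A : Set} → List A → List A → List A
interleave (x ∷ xs) (y ∷ ys) = x ∷ y ∷ interleave xs ys
interleave _        _        = []

interleave-↭ : ∀ {A : Set} (xs ys : List A) → length xs ≡ length ys → interleave xs ys ↭ xs ++ ys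
interleave-↭ []       []       _ = ↭-refl
interleave-↭ (x ∷ xs) (y ∷ ys) e = ↭-prep x
    (↭-trans (↭-prep y (interleave-↭ xs ys (suc-injective e))) (↭-sym (shift y xs ys)))

module Bipartite {n : ℕ} (A : BSet n) (k : ℕ) (2≤k : 2 ≤ k) (#A : # A ≡ k) (2k≤n : 2 * k ≤ n) where
  G = completeBipartite A
  open Cycles G
  open Windows G

  across : ∀ {u v} → u ∈ᵇ A → v ∈ᵇ ∁ᵇ A → u ~ v
  across {u} {v} i j with A u | A v
  ... | true | false = tt

  same-side : ∀ {u v} → u ∈ᵇ ∁ᵇ A → v ∈ᵇ ∁ᵇ A → ¬ u ~ v
  same-side {u} {v} i j with A u | A v
  ... | false | false = λ ()

  interleave-walk : ∀ {x y} xs ys → length xs ≡ length ys →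
    (∀ {v} → v ∈ x ∷ xs → v ∈ᵇ A) → (∀ {v} → v ∈ y ∷ ys → v ∈ᵇ ∁ᵇ A) →
    ∃ λ z → z ∈ᵇ ∁ᵇ A × Walk x z (interleave (x ∷ xs) (y ∷ ys))
  interleave-walk {x} {y} [] [] _ hx hy = y , hy (here refl) , across (hx (here refl)) (hy (here refl)) ∷ʷ single y
  interleave-walk (x′ ∷ xs) (y′ ∷ ys) e hx hy with interleave-walk xs ys (suc-injective e) (hx ∘ there) (hy ∘ there)
  ... | z , h , w = z , h , across (hx (here refl)) (hy (here refl)) ∷ʷ ~-sym
      (across (hx (there (here refl))) (hy (here refl))) ∷ʷ w

  alternating : ∀ {B} → B ⊆ᵇ ∁ᵇ A → # B ≡ k →
    ∃ λ C → IsCycle G C × length C ≡ 2 * k × (∀ v → v ∈ᵇ A ⊎ v ∈ᵇ B → v ∈ C)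
  alternating {B} B⊆ #B = interleave as bs , closed as bs refl refl len-as len-bs , lenC
    , λ v h → ∈-resp-↭ (↭-sym perm)
        ([ (λ i → ∈-++⁺ˡ (∈-elements⁺ {p = A} i)) , (λ i → ∈-++⁺ʳ as (∈-elements⁺ {p = B} i)) ]′ h)
    where
    as = elements A
    bs = elements B
    len-as : length as ≡ k
    len-as = trans (length-elements A) #A
    len-bs : length bs ≡ k
    len-bs = trans (length-elements B) #B
    perm : interleave as bs ↭ as ++ bs
    perm = interleave-↭ as bs (trans len-as (sym len-bs))
    lenC : length (interleave as bs) ≡ 2 * k
    lenC = trans (↭-length perm) (trans (L.length-++ as) (cong₂ _+_ len-as (trans len-bs (sym (+-identityʳ k)))))
    uC : Unique (interleave as bs)
    uC = unique-resp-↭ (↭-sym perm) (unique-++⁺ (elements-unique A) (elements-unique B)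
      λ {v} i j → T-not⇒¬T (B⊆ v (∈-elements⁻ {p = B} j)) (∈-elements⁻ {p = A} i))
    -- The two lists are abstracted by equations so that their heads can be matched on.
    closed : ∀ xs ys → xs ≡ as → ys ≡ bs → length xs ≡ k → length ys ≡ k → IsCycle G (interleave xs ys)
    closed [] _ _ _ e _ = ⊥-elim (<⇒≱ 2≤k (≤-trans (≤-reflexive (sym e)) z≤n))
    closed (x ∷ xs) [] _ _ _ e = ⊥-elim (<⇒≱ 2≤k (≤-trans (≤-reflexive (sym e)) z≤n))
    closed (x ∷ xs) (y ∷ ys) p q e e′ with interleave-walk {x} {y} xs ys (suc-injective (trans e (sym e′)))
      (λ {v} i → ∈-elements⁻ {p = A} (subst (v ∈_) p i)) (λ {v} i → B⊆ v (∈-elements⁻ {p = B} (subst (v ∈_) q i)))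
    ... | z , h , w = walk⇒cycle w (~-sym (across (∈-elements⁻ {p = A} (subst (x ∈_) p (here refl))) h))
      (subst₂ (λ a b → Unique (interleave a b)) (sym p) (sym q) uC)
      (≤-trans (≤-trans (n≤1+n 3) (*-monoʳ-≤ 2 2≤k))
          (≤-reflexive (trans (sym lenC) (cong₂ (λ a b → length (interleave a b)) (sym p) (sym q)))))

  k≤#∁A : k ≤ # (∁ᵇ A)
  k≤#∁A = +-cancelˡ-≤ k _ _ (≤-trans (≤-reflexive (cong (k +_) (sym (+-identityʳ k))))
    (≤-trans 2k≤n (≤-reflexive (trans (sym (#-∁ A)) (cong (_+ # (∁ᵇ A)) #A)))))

  -- The at most k given vertices outside A are filled up to a k-set B on that side, and a cycle
  -- alternating between A and B contains them all.
  kCyclable : KCyclable k G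
  kCyclable S ∣S∣ =
    let B , p⊆B , B⊆ , #B = #-choose (p ∩ᵇ ∁ᵇ A) (∁ᵇ A) k (λ v i → proj₂ (∈∩⁻ {p v} i))
          (≤-trans (#-mono {q = p} (λ v i → proj₁ (∈∩⁻ {p v} i))) (≤-reflexive (trans (#-lookup S) ∣S∣))) k≤#∁A
        C , c , _ , h = alternating B⊆ #B
    in C , c , λ v i → h v ([ inj₁ , (λ j → inj₂ (p⊆B v (∈∩⁺ (∈ᵇ-lookup S i) j))) ]′ (T⊎T-not (A v)))
    where
    p : BSet n
    p = lookup S

  circumference : IsCircumference G (2 * k)
  circumference with #-choose-⊆ (∁ᵇ A) k k≤#∁A
  ... | B , B⊆ , #B = let C , c , l , _ = alternating B⊆ #B in (C , c , l) , bound
    where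
    bound : ∀ C → IsCycle G C → length C ≤ 2 * k
    bound C c = begin
      length C                                  ≡⟨ trans (sym (#-mem (cycle-unique c))) (#-split (mem C) A) ⟩
      a + # (mem C ∩ᵇ ∁ᵇ A)                     ≤⟨ +-monoʳ-≤ a b≤a ⟩
      a + a                                     ≤⟨ +-mono-≤ a≤k a≤k ⟩
      k + k                                     ≡⟨ cong (k +_) (+-identityʳ k) ⟨
      2 * k                                     ∎
      where
      open ≤-Reasoning
      a = # (mem C ∩ᵇ A)
      b = # (mem C ∩ᵇ ∁ᵇ A)
      a≤k : a ≤ k
      a≤k = ≤-trans (#-mono {q = A} λ v i → proj₂ (∈∩⁻ {mem C v} i)) (≤-reflexive #A)
      -- The side outside A is independent, so it fills at most half of the cycle.
      b≤a : b ≤ a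
      b≤a = +-cancelʳ-≤ b b a (begin
        b + b                        ≡⟨ cong (b +_) (+-identityʳ b) ⟨
        2 * b                        ≤⟨ *-monoʳ-≤ 2 (#-mono λ v i → let x , y = ∈∩⁻ {mem C v} i in ∈∩⁺ y x) ⟩
        2 * # (∁ᵇ A ∩ᵇ mem C)        ≤⟨ independent-cycle {p = ∁ᵇ A} (λ u v → same-side) c ⟩
        length C                     ≡⟨ trans (sym (#-mem (cycle-unique c))) (#-split (mem C) A) ⟩
        a + b                        ∎)

-- The bounds and the sharpness example in terms of n and k

2k≤n : ∀ n k → 4 ≤ n → 2 ≤ k → k * k ≤ n + 3 → 2 * k ≤ n
2k≤n n 1 _ (s≤s ()) _
2k≤n n 2 4≤n _ _ = 4≤n
2k≤n n 3 _ _ h = +-cancelʳ-≤ 3 6 n h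
2k≤n n (suc (suc (suc (suc j)))) _ _ h with 2 * (4 + j) ≤? n
... | yes p = p
-- For k = 4 + j, the number k² - 3 exceeds 2k by 5 + 6j + j².
... | no ¬p = ⊥-elim (≤-absurd (5 + 6 * j + j * j) (+-mono-≤ h (≰⇒> ¬p)) (lem n j))
  where
  lem : ∀ n j → (4 + j) * (4 + j) + suc n ≡ suc (n + 3 + 2 * (4 + j) + (5 + 6 * j + j * j))
  lem = solve-∀

-- Ears require sets of three vertices, so k = 2 is treated apart; there `4 ≤ n` excludes the
-- triangle, which is 2-cyclable with circumference three.
circumference≥2k : ∀ n k (G : Graph n) → 2 ≤ k → k ≤ n → KCyclable k G → 4 ≤ n → k * k ≤ n + 3 →
  ∀ c → IsCircumference G c → 2 * k ≤ c
circumference≥2k n k G 2≤k k≤n cyclable 4≤n k² c ((D , cD , refl) , longest) with 2 * k ≤? length D | m≤n⇒m<n∨m≡n 2≤k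
... | yes h | _ = h
... | no h | inj₂ refl = ⊥-elim (two-cyclable-absurd G 4≤n cyclable λ C cC → ≤-trans (longest C cC) (≤-pred (≰⇒> h)))
... | no h | inj₁ 3≤k  = ⊥-elim (LongestCycle.longest-absurd G k 3≤k k≤n cyclable cD longest (≰⇒> h) k²)

circumference≥k+2 : ∀ n k (G : Graph n) → 2 ≤ k → k ≤ n → KCyclable k G → 4 * (k + 1) ≤ 3 * n →
  ∀ c → IsCircumference G c → k + 2 ≤ c
circumference≥k+2 n k G 2≤k k≤n cyclable small c ((D , cD , refl) , longest)
  with k + 2 ≤? length D | m≤n⇒m<n∨m≡n 2≤k | m≤n⇒∃[o]m+o≡n k≤n
... | yes h | _ | _ = h
... | no h | inj₂ refl | _ = ⊥-elim
    (two-cyclable-absurd G (*-cancelˡ-≤ 3 small) cyclable λ C cC → ≤-trans (longest C cC) (≤-pred (≰⇒> h)))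
-- With n = k + q, the hypothesis 4(k + 1) ≤ 3n reads k + 4 ≤ 3q.
... | no h | inj₁ 3≤k | q , refl = ⊥-elim (NearSpanningAbsurd.absurd G k q refl 3≤k
      (+-cancelˡ-≤ (3 * k) _ _ (subst₂ _≤_ (lem₁ k) (lem₂ k q) small)) cyclable
      λ C cC → ≤-trans (longest C cC) (≤-pred (≤-trans (≰⇒> h) (≤-reflexive (+-comm k 2)))))
  where
  lem₁ : ∀ k → 4 * (k + 1) ≡ 3 * k + (k + 4)
  lem₁ = solve-∀
  lem₂ : ∀ k q → 3 * (k + q) ≡ 3 * k + 3 * q
  lem₂ = solve-∀

sharpness : ∀ n k → 4 ≤ n → 2 ≤ k → k ≤ n → k * k ≤ n + 3 → Σ (Graph n) λ G →
    KCyclable k G × IsCircumference G (2 * k)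
sharpness n k 4≤n 2≤k k≤n k²
  with #-choose-⊆ (fullᵇ {n}) k (≤-trans k≤n (≤-reflexive (sym #-full)))
... | A , _ , #A = completeBipartite A , kCyclable , circumference
  where open Bipartite A k 2≤k #A (2k≤n n k 4≤n 2≤k k²)

theorem1 : ((n k : ℕ) (G : Graph n) → 2 ≤ k → k ≤ n → KCyclable k G →
    ((4 ≤ n → k * k ≤ n + 3 → ∀ c → IsCircumference G c → 2 * k ≤ c)
    × (4 * (k + 1) ≤ 3 * n → ∀ c → IsCircumference G c → k + 2 ≤ c)))
    × ((n k : ℕ) → 4 ≤ n → 2 ≤ k → k ≤ n → k * k ≤ n + 3 →
    Σ (Graph n) λ G → KCyclable k G × IsCircumference G (2 * k))
theorem1 =
  (λ n k G 2≤k k≤n cyclable → circumference≥2k n k G 2≤k k≤n cyclable , circumference≥k+2 n k G 2≤k k≤n cyclable) , sharpness
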